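{- Let $p$ be an odd prime, $q=p^2$, $r\in\mathbb{N}^*$ and $A=(x^{q}-x)^{2r}\in\mathbb{F}_q[x]$. Then $A$ is bi-unitary perfect over $\mathbb{F}_q$ if and only if $r\in\Omega$, where $\Omega=\Omega_1\cup\Omega_2\cup\Omega_3\cup\Omega_4$ is the set of positive integers defined by $$\Omega_1=\{N : N \text{ and } 2N+2 \text{ both divide } p^2-1\},$$ $$\Omega_2=\{pN : N \text{ and } 2pN+2 \text{ both divide } p^2-1\},$$ $$\Omega_3=\{N : N\mid p^2-1 \text{ and } 2N+2=Mp \text{ for some } M\mid p^2-1\},$$ $$\Omega_4=\{N : N\mid p^2-1 \text{ and } 2N+2=Mp^2 \text{ for some } M\mid p^2-1\}$$ ($N$ and $M$ denoting positive integers).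
   Context: $\mathbb{N}^*$ is the set of positive integers; $\mathbb{F}_q$ is the field with $q$ elements. All divisors of polynomials are taken monic. For a monic polynomial $S$ over a finite field, a divisor $D$ of $S$ is unitary if $\gcd(D,S/D)=1$; $\gcd_u(S,T)$ denotes the greatest common unitary divisor of $S$ and $T$; a divisor $D$ of $S$ is bi-unitary if $\gcd_u(D,S/D)=1$. $\sigma^{**}(S)$ is the sum of all bi-unitary divisors of $S$, and $S$ is bi-unitary perfect if $\sigma^{**}(S)=S$. -}

module Defs where

open import Algebra.Apartness.Bundles using (HeytingField; HeytingCommutativeRing)
open import Algebra.Bundles using (CommutativeRing)
open import Algebra.Bundles.Raw using (RawRing)
import Algebra.Definitions.RawMagma as RawMagmaDefs
import Algebra.Definitions.RawSemiring as RawSemiringDefs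
open import Data.Fin.Base using (Fin)
open import Data.List.Base using (List; []; _∷_; map; foldr)
import Data.List.Membership.Setoid as Membership
import Data.List.Relation.Unary.Unique.Setoid as UniqueSetoid
open import Data.Nat.Base as ℕ using (ℕ; zero; suc; _<_; _∸_)
open import Data.Nat.Divisibility as ℕ using ()
open import Data.Product.Base using (∃; _×_)
open import Function.Bundles using (Inverse; _⇔_)
open import Level using (Level; _⊔_; 0ℓ)
open import Relation.Binary.Bundles using (Setoid)
open import Relation.Binary.PropositionalEquality as ≡ using (_≡_)
open import Relation.Unary using (Pred; _∪_)

private
  variable
    c ℓ ℓ₁ ℓ₂ : Level

fieldRing : HeytingField c ℓ₁ ℓ₂ → CommutativeRing c ℓ₁
fieldRing F = HeytingCommutativeRing.commutativeRing (HeytingField.heytingCommutativeRing F)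

-- F has exactly q elements up to its equality.  Equality is then decidable,
-- so by tightness the apartness of F is inequality, and the Heyting field F
-- is a field in the usual sense.
HasOrder : HeytingField c ℓ₁ ℓ₂ → ℕ → Set (c ⊔ ℓ₁)
HasOrder F q = Inverse (CommutativeRing.setoid (fieldRing F)) (≡.setoid (Fin q))

module Polynomial (R : CommutativeRing c ℓ) where

  private
    module R = CommutativeRing R

  -- Coefficients in order of increasing degree.  Trailing zeros are allowed;
  -- they are invisible to the equality _≈_ below.
  Poly : Set c
  Poly = List R.Carrier

  coeff : Poly → ℕ → R.Carrier
  coeff []      n       = R.0#
  coeff (a ∷ P) zero    = a
  coeff (a ∷ P) (suc n) = coeff P n

  infix 4 _≈_
  record _≈_ (P Q : Poly) : Set ℓ where
    constructor mk≈
    field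
      coeff-≈ : ∀ n → coeff P n R.≈ coeff Q n
  open _≈_ public

  polySetoid : Setoid c ℓ
  polySetoid = record
    { Carrier       = Poly
    ; _≈_           = _≈_
    ; isEquivalence = record
      { refl  = mk≈ λ n → R.refl
      ; sym   = λ P≈Q → mk≈ λ n → R.sym (coeff-≈ P≈Q n)
      ; trans = λ P≈Q Q≈S → mk≈ λ n → R.trans (coeff-≈ P≈Q n) (coeff-≈ Q≈S n)
      }
    }

  infixl 6 _+_ _-_
  infixl 7 _*_
  infix  8 -_

  _+_ : Poly → Poly → Poly
  []      + Q       = Q
  (a ∷ P) + []      = a ∷ P
  (a ∷ P) + (b ∷ Q) = a R.+ b ∷ P + Q

  -_ : Poly → Poly
  - P = map R.-_ P

  _-_ : Poly → Poly → Poly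
  P - Q = P + (- Q)

  -- (a + x P) Q = a Q + x (P Q)
  _*_ : Poly → Poly → Poly
  []      * Q = []
  (a ∷ P) * Q = map (a R.*_) Q + (R.0# ∷ P * Q)

  0ₚ 1ₚ X : Poly
  0ₚ = []
  1ₚ = R.1# ∷ []
  X  = R.0# ∷ R.1# ∷ []

  polyRawRing : RawRing c ℓ
  polyRawRing = record
    { Carrier = Poly
    ; _≈_     = _≈_
    ; _+_     = _+_
    ; _*_     = _*_
    ; -_      = -_
    ; 0#      = 0ₚ
    ; 1#      = 1ₚ
    }

  open RawMagmaDefs (RawRing.*-rawMagma polyRawRing) public using (_∣_)
  open RawSemiringDefs (RawRing.rawSemiring polyRawRing) public using (_^_)

  Monic : Poly → Set ℓ
  Monic P = ∃ λ d → coeff P d R.≈ R.1# × (∀ n → d < n → coeff P n R.≈ R.0#)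

  -- G = gcd(S,T)
  record IsGCD (S T G : Poly) : Set (c ⊔ ℓ) where
    field
      monic    : Monic G
      divides₁ : G ∣ S
      divides₂ : G ∣ T
      greatest : ∀ {D} → Monic D → D ∣ S → D ∣ T → D ∣ G

  -- E is the quotient S/D, which is unique because D is monic.
  IsUnitaryDivisor : Poly → Poly → Set (c ⊔ ℓ)
  IsUnitaryDivisor D S = Monic D × ∃ λ E → E * D ≈ S × IsGCD D E 1ₚ

  -- G = gcd_u(S,T).  As for the gcd, "greatest" refers to divisibility.
  record IsGCDᵤ (S T G : Poly) : Set (c ⊔ ℓ) where
    field
      unitary₁ : IsUnitaryDivisor G S
      unitary₂ : IsUnitaryDivisor G T
      greatest : ∀ {D} → IsUnitaryDivisor D S → IsUnitaryDivisor D T → D ∣ G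

  IsBiUnitaryDivisor : Poly → Poly → Set (c ⊔ ℓ)
  IsBiUnitaryDivisor D S = Monic D × ∃ λ E → E * D ≈ S × IsGCDᵤ D E 1ₚ

  open Membership polySetoid using (_∈_)
  open UniqueSetoid polySetoid using (Unique)

  -- T = σ**(S).  Membership and uniqueness are up to _≈_, so the list contains
  -- exactly one representative of each bi-unitary divisor of S; hence T is
  -- determined by S up to _≈_.
  record IsSigma** (S T : Poly) : Set (c ⊔ ℓ) where
    field
      divisors   : List Poly
      unique     : Unique divisors
      enumerates : ∀ {D} → D ∈ divisors ⇔ IsBiUnitaryDivisor D S
      sum≈       : foldr _+_ 0ₚ divisors ≈ T

  BiUnitaryPerfect : Poly → Set (c ⊔ ℓ)
  BiUnitaryPerfect S = IsSigma** S S

-- The truncated subtraction below is harmless, as p ^ 2 ≥ 1 for a prime p.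

Ω₁ Ω₂ Ω₃ Ω₄ Ω : ℕ → Pred ℕ 0ℓ
Ω₁ p N = 0 < N × N ℕ.∣ p ℕ.^ 2 ∸ 1 × 2 ℕ.* N ℕ.+ 2 ℕ.∣ p ℕ.^ 2 ∸ 1
Ω₂ p r = ∃ λ N → 0 < N × r ≡ p ℕ.* N ×
         N ℕ.∣ p ℕ.^ 2 ∸ 1 × 2 ℕ.* p ℕ.* N ℕ.+ 2 ℕ.∣ p ℕ.^ 2 ∸ 1
Ω₃ p N = 0 < N × N ℕ.∣ p ℕ.^ 2 ∸ 1 ×
         ∃ λ M → 0 < M × M ℕ.∣ p ℕ.^ 2 ∸ 1 × 2 ℕ.* N ℕ.+ 2 ≡ M ℕ.* p
Ω₄ p N = 0 < N × N ℕ.∣ p ℕ.^ 2 ∸ 1 ×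
         ∃ λ M → 0 < M × M ℕ.∣ p ℕ.^ 2 ∸ 1 × 2 ℕ.* N ℕ.+ 2 ≡ M ℕ.* p ℕ.^ 2
Ω p = Ω₁ p ∪ Ω₂ p ∪ Ω₃ p ∪ Ω₄ p

{-# OPTIONS --safe #-}
module Submission where

-- Since x^q - x = ∏ (x - a) over the q field elements a, a bi-unitary divisor of
-- A is a product of powers (x - a)^e with e ≤ 2r and e ≠ r, so σ**(A) is the
-- product over a of f(x - a), where
--   f = Σ xᵉ (0 ≤ e ≤ 2r, e ≠ r) = (xʳ⁺¹ + 1) (xʳ - 1) / (x - 1).
-- If f = ∏ (x - c), then ∏ f(x - a) = ∏ ∏ (x - (a + c)) = (x^q - x)^(2r), since a ↦ a + c
-- permutes the field; conversely f divides ∏ f(x - a).  Hence A is perfect iff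
-- xʳ - 1 and xʳ⁺¹ + 1 split.  By Frobenius, xᵖⁿ - u splits iff xⁿ - u does when
-- u = ± 1.  For n prime to p the roots of xⁿ - u are simple, so it splits iff it
-- divides x^(q-1) - 1; reducing modulo xⁿ - u, this happens iff q - 1 = n s with uˢ = 1,
-- which means n ∣ q - 1 for u = 1 and 2n ∣ q - 1 for u = -1.

open import Defs
open import Algebra.Apartness.Bundles using (HeytingField)
open import Algebra.Bundles using (CommutativeRing; CommutativeSemiring)
open import Algebra.Bundles.Raw using (RawRing)
import Algebra.Definitions.RawMagma as RawMagmaDefs
import Algebra.Properties.CommutativeSemiring.Binomial as Binomial
import Algebra.Properties.CommutativeSemiring.Exp as CommutativeExp
import Algebra.Properties.Group as GroupProperties
import Algebra.Properties.Ring as RingProperties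
import Algebra.Properties.Semiring.Exp as Exp
import Algebra.Properties.Semiring.Mult as Mult
import Algebra.Properties.Semiring.Sum as Sum
import Algebra.Solver.Ring.NaturalCoefficients.Default as SemiringSolver
open import Data.Fin.Base as Fin using (Fin; toℕ; fromℕ; fromℕ<; inject₁)
import Data.Fin.Properties as Fin
open import Data.List.Base using (List; []; _∷_; _++_; map; foldr; filter; length; tabulate; downFrom; cartesianProductWith)
open import Data.List.Membership.Propositional using () renaming (_∈_ to _∈ₙ_)
import Data.List.Membership.Propositional.Properties as MembershipPₙ
import Data.List.Membership.Setoid as Membership
import Data.List.Membership.Setoid.Properties as MembershipP
import Data.List.Properties as List
import Data.List.Relation.Binary.Permutation.Setoid as Permutation
import Data.List.Relation.Binary.Permutation.Setoid.Properties as PermutationP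
open import Data.List.Relation.Unary.All as All using ([]; _∷_)
open import Data.List.Relation.Unary.AllPairs using ([]; _∷_)
open import Data.List.Relation.Unary.Any using (here; there)
open import Data.List.Relation.Unary.Unique.Propositional using () renaming (Unique to Uniqueₙ)
import Data.List.Relation.Unary.Unique.Propositional.Properties as UniquePₙ
import Data.List.Relation.Unary.Unique.Setoid as UniqueSetoid
import Data.List.Relation.Unary.Unique.Setoid.Properties as UniqueP
open import Data.Nat.Base as ℕ using (ℕ; zero; suc; _<_; s≤s; z<s; s<s; NonZero)
import Data.Nat.Combinatorics as ℕ
open import Data.Nat.Coprimality using (Coprime; coprime-Bézout)
open import Data.Nat.Divisibility as ℕ using ()
import Data.Nat.DivMod as ℕ
open import Data.Nat.GCD using (module Bézout)
open import Data.Nat.Primality using (Prime; euclidsLemma; prime[2]; prime⇒irreducible; prime⇒nonTrivial)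
import Data.Nat.Properties as ℕ
open import Data.Product.Base using (∃; ∃₂; _×_; _,_; proj₁; proj₂)
open import Data.Sum.Base using (_⊎_; inj₁; inj₂)
open import Function.Base using (id; _∘_)
open import Function.Bundles using (_⇔_; mk⇔; Equivalence; Inverse)
open import Function.Construct.Composition using (_⇔-∘_)
open import Level using (Level; _⊔_)
open import Relation.Binary.Bundles using (Setoid)
open import Relation.Binary.Core using (_Preserves_⟶_)
open import Relation.Binary.Definitions using (Decidable; tri<; tri≈; tri>)
open import Relation.Binary.PropositionalEquality.Core as ≡ using (_≡_)
import Relation.Binary.PropositionalEquality.Properties as ≡
import Relation.Binary.Reasoning.Setoid as SetoidReasoning
open import Relation.Nullary.Decidable.Core using (Dec; yes; no; ¬?; map′; decidable-stable)
open import Relation.Nullary.Negation using (¬_; contradiction)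

-- Polynomials as a commutative ring

-- The condition e ≠ r arises because the only unitary divisors of (x - a)^e are 1 and (x - a)^e
-- itself: a divisor with exponent e at a and its cofactor with exponent 2r - e share a nontrivial
-- one at a exactly when e = 2r - e. Unique factorisation is not developed in general. All factors
-- in play are linear, and evaluation at a decides divisibility by x - a, so distributing the copies
-- of x - a over two cofactors (`split`) takes its place. That a polynomial splits is expressed as
-- dividing some power of ∏ (x - a). This form passes to divisors, products and p-th powers without
-- naming roots; a list of roots is extracted only once, to form the translates f(x - a). The four
-- sets come from a bound on the power of p. At most one of r and r + 1 is divisible by p, and the
-- other one satisfies a divisibility into p² - 1. If p ∣ r, then 2(r + 1) ∣ p² - 1, so p² cannot
-- divide r. If p does not divide r, then r ∣ p² - 1, hence r + 1 ≤ p², and r + 1 may contain p⁰, p¹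
-- or p².

module PolynomialRing {c ℓ : Level} (R : CommutativeRing c ℓ) where

  private
    module R = CommutativeRing R
    module RP = RingProperties R.ring

  open Polynomial R
  open SetoidReasoning R.setoid

  private
    reflₚ : ∀ {P} → P ≈ P
    reflₚ = mk≈ λ _ → R.refl

    transₚ : ∀ {P Q S} → P ≈ Q → Q ≈ S → P ≈ S
    transₚ P≈Q Q≈S = mk≈ λ n → R.trans (coeff-≈ P≈Q n) (coeff-≈ Q≈S n)

    symₚ : ∀ {P Q} → P ≈ Q → Q ≈ P
    symₚ P≈Q = mk≈ λ n → R.sym (coeff-≈ P≈Q n)

  coeff-+ : ∀ P Q n → coeff (P + Q) n R.≈ coeff P n R.+ coeff Q n
  coeff-+ []      Q       n       = R.sym (R.+-identityˡ _)
  coeff-+ (a ∷ P) []      n       = R.sym (R.+-identityʳ _)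
  coeff-+ (a ∷ P) (b ∷ Q) zero    = R.refl
  coeff-+ (a ∷ P) (b ∷ Q) (suc n) = coeff-+ P Q n

  infixr 7 _∙_
  _∙_ : R.Carrier → Poly → Poly
  a ∙ P = map (a R.*_) P

  coeff-∙ : ∀ a P n → coeff (a ∙ P) n R.≈ a R.* coeff P n
  coeff-∙ a []      n       = R.sym (R.zeroʳ a)
  coeff-∙ a (b ∷ P) zero    = R.refl
  coeff-∙ a (b ∷ P) (suc n) = coeff-∙ a P n

  coeff-neg : ∀ P n → coeff (- P) n R.≈ R.- coeff P n
  coeff-neg []      n       = R.sym RP.-0#≈0#
  coeff-neg (a ∷ P) zero    = R.refl
  coeff-neg (a ∷ P) (suc n) = coeff-neg P n

  private
    +-cong : ∀ {P P′ Q Q′} → P ≈ P′ → Q ≈ Q′ → P + Q ≈ P′ + Q′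
    +-cong {P} {P′} {Q} {Q′} p q = mk≈ λ n → begin
      coeff (P + Q) n               ≈⟨ coeff-+ P Q n ⟩
      coeff P n R.+ coeff Q n       ≈⟨ R.+-cong (coeff-≈ p n) (coeff-≈ q n) ⟩
      coeff P′ n R.+ coeff Q′ n     ≈⟨ coeff-+ P′ Q′ n ⟨
      coeff (P′ + Q′) n             ∎

    neg-cong : ∀ {P Q} → P ≈ Q → - P ≈ - Q
    neg-cong {P} {Q} p = mk≈ λ n →
      R.trans (coeff-neg P n) (R.trans (R.-‿cong (coeff-≈ p n)) (R.sym (coeff-neg Q n)))

    +-assoc : ∀ P Q S → (P + Q) + S ≈ P + (Q + S)
    +-assoc P Q S = mk≈ λ n → begin
      coeff ((P + Q) + S) n                       ≈⟨ coeff-+ (P + Q) S n ⟩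
      coeff (P + Q) n R.+ coeff S n               ≈⟨ R.+-congʳ (coeff-+ P Q n) ⟩
      (coeff P n R.+ coeff Q n) R.+ coeff S n     ≈⟨ R.+-assoc _ _ _ ⟩
      coeff P n R.+ (coeff Q n R.+ coeff S n)     ≈⟨ R.+-congˡ (coeff-+ Q S n) ⟨
      coeff P n R.+ coeff (Q + S) n               ≈⟨ coeff-+ P (Q + S) n ⟨
      coeff (P + (Q + S)) n                       ∎

    +-comm : ∀ P Q → P + Q ≈ Q + P
    +-comm P Q = mk≈ λ n →
      R.trans (coeff-+ P Q n) (R.trans (R.+-comm _ _) (R.sym (coeff-+ Q P n)))

    +-identityˡ : ∀ P → 0ₚ + P ≈ P
    +-identityˡ P = reflₚ

    +-identityʳ : ∀ P → P + 0ₚ ≈ P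
    +-identityʳ P = transₚ (+-comm P 0ₚ) reflₚ

    inverseʳ : ∀ P → P + - P ≈ 0ₚ
    inverseʳ P = mk≈ λ n → begin
      coeff (P + - P) n              ≈⟨ coeff-+ P (- P) n ⟩
      coeff P n R.+ coeff (- P) n    ≈⟨ R.+-congˡ (coeff-neg P n) ⟩
      coeff P n R.+ R.- coeff P n    ≈⟨ R.-‿inverseʳ _ ⟩
      R.0#                           ∎

    inverseˡ : ∀ P → - P + P ≈ 0ₚ
    inverseˡ P = transₚ (+-comm (- P) P) (inverseʳ P)

    ∷-cong : ∀ {a b P Q} → a R.≈ b → P ≈ Q → a ∷ P ≈ b ∷ Q
    ∷-cong a≈b P≈Q = mk≈ λ { zero → a≈b ; (suc n) → coeff-≈ P≈Q n }

    0∷-≈[] : ∀ {P} → P ≈ 0ₚ → R.0# ∷ P ≈ 0ₚ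
    0∷-≈[] P≈0 = mk≈ λ { zero → R.refl ; (suc n) → coeff-≈ P≈0 n }

    0∷-+ : ∀ P Q → R.0# ∷ (P + Q) ≈ (R.0# ∷ P) + (R.0# ∷ Q)
    0∷-+ P Q = ∷-cong (R.sym (R.+-identityˡ R.0#)) reflₚ

    ∙-cong : ∀ {a b P Q} → a R.≈ b → P ≈ Q → a ∙ P ≈ b ∙ Q
    ∙-cong {a} {b} {P} {Q} a≈b P≈Q = mk≈ λ n →
      R.trans (coeff-∙ a P n) (R.trans (R.*-cong a≈b (coeff-≈ P≈Q n)) (R.sym (coeff-∙ b Q n)))

    ∙-zero : ∀ {a} P → a R.≈ R.0# → a ∙ P ≈ 0ₚ
    ∙-zero {a} P a≈0 = mk≈ λ n →
      R.trans (coeff-∙ a P n) (R.trans (R.*-congʳ a≈0) (R.zeroˡ _))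

    ∙-distribʳ : ∀ a P Q → a ∙ (P + Q) ≈ a ∙ P + a ∙ Q
    ∙-distribʳ a P Q = mk≈ λ n → begin
      coeff (a ∙ (P + Q)) n                     ≈⟨ coeff-∙ a (P + Q) n ⟩
      a R.* coeff (P + Q) n                     ≈⟨ R.*-congˡ (coeff-+ P Q n) ⟩
      a R.* (coeff P n R.+ coeff Q n)           ≈⟨ R.distribˡ _ _ _ ⟩
      a R.* coeff P n R.+ a R.* coeff Q n       ≈⟨ R.+-cong (coeff-∙ a P n) (coeff-∙ a Q n) ⟨
      coeff (a ∙ P) n R.+ coeff (a ∙ Q) n       ≈⟨ coeff-+ (a ∙ P) (a ∙ Q) n ⟨
      coeff (a ∙ P + a ∙ Q) n                   ∎

    ∙-distribˡ : ∀ a b P → (a R.+ b) ∙ P ≈ a ∙ P + b ∙ P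
    ∙-distribˡ a b P = mk≈ λ n → begin
      coeff ((a R.+ b) ∙ P) n                   ≈⟨ coeff-∙ (a R.+ b) P n ⟩
      (a R.+ b) R.* coeff P n                   ≈⟨ R.distribʳ _ _ _ ⟩
      a R.* coeff P n R.+ b R.* coeff P n       ≈⟨ R.+-cong (coeff-∙ a P n) (coeff-∙ b P n) ⟨
      coeff (a ∙ P) n R.+ coeff (b ∙ P) n       ≈⟨ coeff-+ (a ∙ P) (b ∙ P) n ⟨
      coeff (a ∙ P + b ∙ P) n                   ∎

    ∙-assoc : ∀ a b P → (a R.* b) ∙ P ≈ a ∙ b ∙ P
    ∙-assoc a b P = mk≈ λ n → begin
      coeff ((a R.* b) ∙ P) n       ≈⟨ coeff-∙ (a R.* b) P n ⟩
      (a R.* b) R.* coeff P n       ≈⟨ R.*-assoc _ _ _ ⟩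
      a R.* (b R.* coeff P n)       ≈⟨ R.*-congˡ (coeff-∙ b P n) ⟨
      a R.* coeff (b ∙ P) n         ≈⟨ coeff-∙ a (b ∙ P) n ⟨
      coeff (a ∙ b ∙ P) n           ∎

    ∙-0∷ : ∀ a P → a ∙ (R.0# ∷ P) ≈ R.0# ∷ a ∙ P
    ∙-0∷ a P = ∷-cong (R.zeroʳ a) reflₚ

    +-interchange : ∀ P Q S T → (P + Q) + (S + T) ≈ (P + S) + (Q + T)
    +-interchange P Q S T =
      transₚ (+-assoc P Q (S + T))
      (transₚ (+-cong (reflₚ {P}) (transₚ (symₚ (+-assoc Q S T)) (transₚ (+-cong (+-comm Q S) reflₚ) (+-assoc S Q T))))
      (symₚ (+-assoc P S (Q + T))))

    *-zeroʳ : ∀ P → P * 0ₚ ≈ 0ₚ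
    *-zeroʳ []      = reflₚ
    *-zeroʳ (a ∷ P) = 0∷-≈[] (*-zeroʳ P)

    *-zeroˡ′ : ∀ {P} → P ≈ 0ₚ → ∀ Q → P * Q ≈ 0ₚ
    *-zeroˡ′ {[]}    P≈0 Q = reflₚ
    *-zeroˡ′ {a ∷ P} P≈0 Q = transₚ
      (+-cong (∙-zero Q (coeff-≈ P≈0 zero)) (0∷-≈[] (*-zeroˡ′ {P} (mk≈ λ n → coeff-≈ P≈0 (suc n)) Q)))
      reflₚ

    *-congʳ : ∀ {P P′} Q → P ≈ P′ → P * Q ≈ P′ * Q
    *-congʳ {[]}    {P′}     Q e = symₚ (*-zeroˡ′ (symₚ e) Q)
    *-congʳ {a ∷ P} {[]}     Q e = *-zeroˡ′ e Q
    *-congʳ {a ∷ P} {b ∷ P′} Q e =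
      +-cong (∙-cong (coeff-≈ e zero) reflₚ)
             (∷-cong R.refl (*-congʳ {P} {P′} Q (mk≈ λ n → coeff-≈ e (suc n))))

    *-congˡ : ∀ P {Q Q′} → Q ≈ Q′ → P * Q ≈ P * Q′
    *-congˡ []      e = reflₚ
    *-congˡ (a ∷ P) e = +-cong (∙-cong R.refl e) (∷-cong R.refl (*-congˡ P e))

    -- Multiplication recurses on its left factor only; this is the mirrored recursion, from which
    -- commutativity follows by induction.
    *-∷ : ∀ P b Q → P * (b ∷ Q) ≈ b ∙ P + (R.0# ∷ P * Q)
    *-∷ []      b Q = symₚ (0∷-≈[] reflₚ)
    *-∷ (a ∷ P) b Q = ∷-cong (R.+-congʳ (R.*-comm a b)) (transₚ
      (+-cong (reflₚ {a ∙ Q}) (*-∷ P b Q)) (transₚ (symₚ (+-assoc (a ∙ Q) (b ∙ P) _)) (transₚ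
        (+-cong (+-comm (a ∙ Q) (b ∙ P)) reflₚ) (+-assoc (b ∙ P) (a ∙ Q) _))))

    *-comm : ∀ P Q → P * Q ≈ Q * P
    *-comm []      Q = symₚ (*-zeroʳ Q)
    *-comm (a ∷ P) Q = transₚ (+-cong reflₚ (∷-cong R.refl (*-comm P Q))) (symₚ (*-∷ Q a P))

    *-distribʳ : ∀ Q P P′ → (P + P′) * Q ≈ P * Q + P′ * Q
    *-distribʳ Q []      P′       = reflₚ
    *-distribʳ Q (a ∷ P) []       = symₚ (+-identityʳ _)
    *-distribʳ Q (a ∷ P) (b ∷ P′) = transₚ
      (+-cong (∙-distribˡ a b Q) (transₚ (∷-cong R.refl (*-distribʳ Q P P′)) (0∷-+ (P * Q) (P′ * Q))))
      (+-interchange (a ∙ Q) (b ∙ Q) _ _)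

    *-distribˡ : ∀ Q P P′ → Q * (P + P′) ≈ Q * P + Q * P′
    *-distribˡ Q P P′ = transₚ (*-comm Q _) (transₚ (*-distribʳ Q P P′) (+-cong (*-comm P Q) (*-comm P′ Q)))

    ∙-* : ∀ a P Q → (a ∙ P) * Q ≈ a ∙ (P * Q)
    ∙-* a []      Q = reflₚ
    ∙-* a (b ∷ P) Q = transₚ
      (+-cong (∙-assoc a b Q) (transₚ (∷-cong R.refl (∙-* a P Q)) (symₚ (∙-0∷ a (P * Q)))))
      (symₚ (∙-distribʳ a (b ∙ Q) _))

    0∷-* : ∀ P Q → (R.0# ∷ P) * Q ≈ R.0# ∷ P * Q
    0∷-* P Q = +-cong (∙-zero Q R.refl) reflₚ

    *-assoc : ∀ P Q S → (P * Q) * S ≈ P * (Q * S)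
    *-assoc []      Q S = reflₚ
    *-assoc (a ∷ P) Q S = transₚ (*-distribʳ S (a ∙ Q) (R.0# ∷ P * Q))
      (+-cong (∙-* a Q S) (transₚ (0∷-* (P * Q) S) (∷-cong R.refl (*-assoc P Q S))))

    *-identityˡ : ∀ P → 1ₚ * P ≈ P
    *-identityˡ P = transₚ (+-cong (mk≈ λ n → R.trans (coeff-∙ R.1# P n) (R.*-identityˡ _)) (0∷-≈[] reflₚ)) (+-identityʳ P)

    *-identityʳ : ∀ P → P * 1ₚ ≈ P
    *-identityʳ P = transₚ (*-comm P 1ₚ) (*-identityˡ P)

  polyRing : CommutativeRing c ℓ
  polyRing = record
    { Carrier = Poly
    ; _≈_     = _≈_
    ; _+_     = _+_
    ; _*_     = _*_
    ; -_      = -_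
    ; 0#      = 0ₚ
    ; 1#      = 1ₚ
    ; isCommutativeRing = record
      { isRing = record
        { +-isAbelianGroup = record
          { isGroup = record
            { isMonoid = record
              { isSemigroup = record
                { isMagma = record
                  { isEquivalence = record { refl = reflₚ ; sym = symₚ ; trans = transₚ }
                  ; ∙-cong        = +-cong
                  }
                ; assoc   = +-assoc
                }
              ; identity    = +-identityˡ , +-identityʳ
              }
            ; inverse  = inverseˡ , inverseʳ
            ; ⁻¹-cong  = neg-cong
            }
          ; comm    = +-comm
          }
        ; *-cong     = λ {P} {P′} {Q} {Q′} p q → transₚ (*-congʳ Q p) (*-congˡ P′ q)
        ; *-assoc    = *-assoc
        ; *-identity = *-identityˡ , *-identityʳ
        ; distrib    = *-distribˡ , *-distribʳ
        }
      ; *-comm = *-comm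
      }
    }

  C : R.Carrier → Poly
  C a = a ∷ []

  ∷≈C+X* : ∀ a P → a ∷ P ≈ C a + X * P
  ∷≈C+X* a P = mk≈ λ
    { zero    → R.sym (R.trans (coeff-+ (C a) (X * P) zero) (R.trans (R.+-congˡ (coeff-≈ X*≈ zero)) (R.+-identityʳ a)))
    ; (suc n) → R.sym (R.trans (coeff-+ (C a) (X * P) (suc n)) (R.trans (R.+-congˡ (coeff-≈ X*≈ (suc n))) (R.+-identityˡ _)))
    }
    where
    X*≈ : X * P ≈ R.0# ∷ P
    X*≈ = transₚ (0∷-* 1ₚ P) (∷-cong R.refl (*-identityˡ P))

  C-cong : ∀ {a b} → a R.≈ b → C a ≈ C b
  C-cong a≈b = ∷-cong a≈b reflₚ

  C-0 : C R.0# ≈ 0ₚ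
  C-0 = 0∷-≈[] reflₚ

  C-* : ∀ a b → C (a R.* b) ≈ C a * C b
  C-* a b = ∷-cong (R.sym (R.+-identityʳ _)) reflₚ

-- Evaluation along a ring homomorphism

module Evaluation {c ℓ c′ ℓ′ : Level} (R : CommutativeRing c ℓ) (S : CommutativeRing c′ ℓ′)
  (φ : CommutativeRing.Carrier R → CommutativeRing.Carrier S)
  (φ-cong : φ Preserves CommutativeRing._≈_ R ⟶ CommutativeRing._≈_ S)
  (φ-+ : ∀ a b → CommutativeRing._≈_ S (φ (CommutativeRing._+_ R a b)) (CommutativeRing._+_ S (φ a) (φ b)))
  (φ-* : ∀ a b → CommutativeRing._≈_ S (φ (CommutativeRing._*_ R a b)) (CommutativeRing._*_ S (φ a) (φ b)))
  (φ-0 : CommutativeRing._≈_ S (φ (CommutativeRing.0# R)) (CommutativeRing.0# S))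
  (φ-1 : CommutativeRing._≈_ S (φ (CommutativeRing.1# R)) (CommutativeRing.1# S))
  (y : CommutativeRing.Carrier S) where

  private
    module R = CommutativeRing R
    module S = CommutativeRing S
    module P = Polynomial R

  open PolynomialRing R
  open SetoidReasoning S.setoid
  open SemiringSolver S.commutativeSemiring using (solve; _:+_; _:*_; _:=_)

  -- Serves twice: with φ the identity it is the value at y, and with φ = `C` into the polynomial
  -- ring it is composition.
  eval : P.Poly → S.Carrier
  eval []      = S.0#
  eval (a ∷ P) = φ a S.+ y S.* eval P

  private
    eval-≈0 : ∀ {P} → P P.≈ P.0ₚ → eval P S.≈ S.0#
    eval-≈0 {[]}    e = S.refl
    eval-≈0 {a ∷ P} e = begin
      φ a S.+ y S.* eval P   ≈⟨ S.+-cong (S.trans (φ-cong (P.coeff-≈ e zero)) φ-0)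
                                         (S.*-congˡ {y} (eval-≈0 {P} (P.mk≈ λ n → P.coeff-≈ e (suc n)))) ⟩
      S.0# S.+ y S.* S.0#    ≈⟨ S.+-identityˡ _ ⟩
      y S.* S.0#             ≈⟨ S.zeroʳ y ⟩
      S.0#                   ∎

  eval-cong : ∀ {P Q} → P P.≈ Q → eval P S.≈ eval Q
  eval-cong {[]}    {Q}     e = S.sym (eval-≈0 {Q} (P.mk≈ λ n → R.sym (P.coeff-≈ e n)))
  eval-cong {a ∷ P} {[]}    e = eval-≈0 e
  eval-cong {a ∷ P} {b ∷ Q} e =
    S.+-cong (φ-cong (P.coeff-≈ e zero)) (S.*-congˡ (eval-cong {P} {Q} (P.mk≈ λ n → P.coeff-≈ e (suc n))))

  eval-+ : ∀ P Q → eval (P P.+ Q) S.≈ eval P S.+ eval Q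
  eval-+ []      Q       = S.sym (S.+-identityˡ _)
  eval-+ (a ∷ P) []      = S.sym (S.+-identityʳ _)
  eval-+ (a ∷ P) (b ∷ Q) = begin
    φ (a R.+ b) S.+ y S.* eval (P P.+ Q)                  ≈⟨ S.+-cong (φ-+ a b) (S.*-congˡ (eval-+ P Q)) ⟩
    φ a S.+ φ b S.+ y S.* (eval P S.+ eval Q)             ≈⟨ solve 5 (λ u v y p q → u :+ v :+ y :* (p :+ q) := (u :+ y :* p) :+ (v :+ y :* q)) S.refl (φ a) (φ b) y (eval P) (eval Q) ⟩
    (φ a S.+ y S.* eval P) S.+ (φ b S.+ y S.* eval Q)     ∎

  private
    eval-∙ : ∀ a P → eval (a ∙ P) S.≈ φ a S.* eval P
    eval-∙ a []      = S.sym (S.zeroʳ _)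
    eval-∙ a (b ∷ P) = begin
      φ (a R.* b) S.+ y S.* eval (a ∙ P)       ≈⟨ S.+-cong (φ-* a b) (S.*-congˡ (eval-∙ a P)) ⟩
      φ a S.* φ b S.+ y S.* (φ a S.* eval P)   ≈⟨ solve 4 (λ u v y p → u :* v :+ y :* (u :* p) := u :* (v :+ y :* p)) S.refl (φ a) (φ b) y (eval P) ⟩
      φ a S.* (φ b S.+ y S.* eval P)           ∎

  eval-* : ∀ P Q → eval (P P.* Q) S.≈ eval P S.* eval Q
  eval-* []      Q = S.sym (S.zeroˡ _)
  eval-* (a ∷ P) Q = begin
    eval (a ∙ Q P.+ (R.0# ∷ P P.* Q))                                 ≈⟨ eval-+ (a ∙ Q) (R.0# ∷ P P.* Q) ⟩
    eval (a ∙ Q) S.+ (φ R.0# S.+ y S.* eval (P P.* Q))                ≈⟨ S.+-cong (eval-∙ a Q) (S.+-cong φ-0 (S.*-congˡ (eval-* P Q))) ⟩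
    φ a S.* eval Q S.+ (S.0# S.+ y S.* (eval P S.* eval Q))           ≈⟨ S.+-congˡ (S.+-identityˡ _) ⟩
    φ a S.* eval Q S.+ y S.* (eval P S.* eval Q)                      ≈⟨ solve 4 (λ u y p q → u :* q :+ y :* (p :* q) := (u :+ y :* p) :* q) S.refl (φ a) y (eval P) (eval Q) ⟩
    (φ a S.+ y S.* eval P) S.* eval Q                                 ∎

  eval-C : ∀ a → eval (C a) S.≈ φ a
  eval-C a = S.trans (S.+-congˡ (S.zeroʳ y)) (S.+-identityʳ _)

  eval-1 : eval P.1ₚ S.≈ S.1#
  eval-1 = S.trans (eval-C R.1#) φ-1

  eval-X : eval P.X S.≈ y
  eval-X = S.trans (S.+-cong φ-0 (S.trans (S.*-congˡ eval-1) (S.*-identityʳ y))) (S.+-identityˡ y)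

  eval-neg : ∀ P → eval (P.- P) S.≈ S.- eval P
  eval-neg P = GroupProperties.inverseˡ-unique S.+-group _ _
    (S.trans (S.sym (eval-+ (P.- P) P)) (eval-≈0 {P.- P P.+ P} (CommutativeRing.-‿inverseˡ polyRing P)))

  eval-- : ∀ P Q → eval (P P.- Q) S.≈ eval P S.- eval Q
  eval-- P Q = S.trans (eval-+ P (P.- Q)) (S.+-congˡ (eval-neg Q))

  eval-^ : ∀ P n → eval (P P.^ n) S.≈ Exp._^_ S.semiring (eval P) n
  eval-^ P zero    = eval-1
  eval-^ P (suc n) = S.trans (eval-* P (P P.^ n)) (S.*-congˡ (eval-^ P n))

-- Decidable fields and leading terms

record IsDecidableField {c ℓ : Level} (R : CommutativeRing c ℓ) : Set (c ⊔ ℓ) where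
  open CommutativeRing R
  infix 4 _≟_
  field
    _≟_     : Decidable _≈_
    1≉0     : ¬ 1# ≈ 0#
    inverse : ∀ {x} → ¬ x ≈ 0# → ∃ λ y → y * x ≈ 1#

  integral : ∀ {x y} → x * y ≈ 0# → x ≈ 0# ⊎ y ≈ 0#
  integral {x} {y} xy≈0 with x ≟ 0#
  ... | yes x≈0 = inj₁ x≈0
  ... | no x≉0  = let (x⁻¹ , x⁻¹x≈1) = inverse x≉0 in inj₂ (trans (sym (*-identityˡ y))
    (trans (*-congʳ (sym x⁻¹x≈1)) (trans (*-assoc x⁻¹ x y) (trans (*-congˡ xy≈0) (zeroʳ x⁻¹)))))

module LeadingTerm {c ℓ : Level} (R : CommutativeRing c ℓ) where

  private
    module R = CommutativeRing R

  open Polynomial R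
  open PolynomialRing R
  private module A = CommutativeRing polyRing

  -- l may vanish, so d is only an upper bound for the degree unless l ≉ 0.
  record Lead (P : Poly) (d : ℕ) (l : R.Carrier) : Set ℓ where
    constructor mkLead
    field
      top   : coeff P d R.≈ l
      above : ∀ n → d < n → coeff P n R.≈ R.0#
  open Lead public

  monic : ∀ {P d} → Lead P d R.1# → Monic P
  monic {d = d} p = d , top p , above p

  monic⁻¹ : ∀ {P} → Monic P → ∃ λ d → Lead P d R.1#
  monic⁻¹ (d , t , a) = d , mkLead t a

  Lead-resp : ∀ {P Q d l} → P ≈ Q → Lead P d l → Lead Q d l
  Lead-resp e (mkLead p h) = mkLead (R.trans (R.sym (coeff-≈ e _)) p) λ n d<n → R.trans (R.sym (coeff-≈ e n)) (h n d<n)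

  Lead-resp-≈ : ∀ {P d l m} → l R.≈ m → Lead P d l → Lead P d m
  Lead-resp-≈ e (mkLead p h) = mkLead (R.trans p e) h

  Lead-∙ : ∀ a {Q e m} → Lead Q e m → Lead (a ∙ Q) e (a R.* m)
  Lead-∙ a {Q} (mkLead q h) = mkLead (R.trans (coeff-∙ a Q _) (R.*-congˡ q))
    λ n e<n → R.trans (coeff-∙ a Q n) (R.trans (R.*-congˡ (h n e<n)) (R.zeroʳ a))

  -- For d > 0 the summand `a ∙ Q` stops at degree e, below d + e, so the top coefficient comes from
  -- the shifted product alone; for d = 0 the tail P is zero.
  Lead-* : ∀ {P Q d e l m} → Lead P d l → Lead Q e m → Lead (P * Q) (d ℕ.+ e) (l R.* m)
  Lead-* {[]}    {Q} p _ = mkLead (R.sym (R.trans (R.*-congʳ (R.sym (top p))) (R.zeroˡ _))) λ _ _ → R.refl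
  Lead-* {a ∷ P} {Q} {zero} p q = Lead-resp-≈ (R.*-congʳ (top p)) (Lead-resp ∙≈* (Lead-∙ a q))
    where
    P≈0 : P ≈ 0ₚ
    P≈0 = mk≈ λ n → above p (suc n) z<s
    0∷≈0 : R.0# ∷ P * Q ≈ 0ₚ
    0∷≈0 = mk≈ λ { zero → R.refl ; (suc n) → coeff-≈ (A.trans (A.*-congʳ {Q} P≈0) A.refl) n }
    ∙≈* : a ∙ Q ≈ (a ∷ P) * Q
    ∙≈* = A.sym (A.trans (A.+-congˡ {a ∙ Q} 0∷≈0) (A.+-identityʳ _))
  Lead-* {a ∷ P} {Q} {suc d} {e} {l} {m} p q = mkLead
    (R.trans (coeff-+ (a ∙ Q) _ _) (R.trans (R.+-cong (small _ (ℕ.m≤n+m e d)) (top PQ)) (R.+-identityˡ _)))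
    λ { (suc n) (s≤s d+e<n) → R.trans (coeff-+ (a ∙ Q) _ _)
          (R.trans (R.+-cong (small _ (ℕ.≤-trans (ℕ.m≤n+m e d) (ℕ.<⇒≤ d+e<n))) (above PQ n d+e<n)) (R.+-identityˡ _)) }
    where
    PQ : Lead (P * Q) (d ℕ.+ e) (l R.* m)
    PQ = Lead-* {P} (mkLead (top p) λ n d<n → above p (suc n) (s<s d<n)) q
    small : ∀ n → e ℕ.≤ n → coeff (a ∙ Q) (suc n) R.≈ R.0#
    small n e≤n = above (Lead-∙ a q) (suc n) (s≤s e≤n)

  Lead-1 : Lead 1ₚ 0 R.1#
  Lead-1 = mkLead R.refl λ { (suc n) _ → R.refl }

  Lead-^ : ∀ {P d} n → Lead P d R.1# → Lead (P ^ n) (n ℕ.* d) R.1#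
  Lead-^ zero    p = Lead-1
  Lead-^ (suc n) p = Lead-resp-≈ (R.*-identityˡ _) (Lead-* p (Lead-^ n p))

  Lead-X : Lead X 1 R.1#
  Lead-X = mkLead R.refl λ { (suc (suc n)) _ → R.refl ; (suc zero) (s≤s ()) }

  Lead-X^ : ∀ n → Lead (X ^ n) n R.1#
  Lead-X^ n = ≡.subst (λ d → Lead (X ^ n) d R.1#) (ℕ.*-identityʳ n) (Lead-^ n Lead-X)

  Lead-+ˡ : ∀ {P Q d l} → Lead P d l → (∀ n → d ℕ.≤ n → coeff Q n R.≈ R.0#) → Lead (P + Q) d l
  Lead-+ˡ {P} {Q} (mkLead p h) k = mkLead
    (R.trans (coeff-+ P Q _) (R.trans (R.+-cong p (k _ ℕ.≤-refl)) (R.+-identityʳ _)))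
    λ n d<n → R.trans (coeff-+ P Q n) (R.trans (R.+-cong (h n d<n) (k n (ℕ.<⇒≤ d<n))) (R.+-identityʳ _))

-- Factorisation into linear factors over a field

module LinearFactors {c ℓ : Level} (R : CommutativeRing c ℓ) (isField : IsDecidableField R) where

  private
    module R = CommutativeRing R

  open IsDecidableField isField
  open Polynomial R
  open RawMagmaDefs (RawRing.*-rawMagma polyRawRing) using (_,_)
  open PolynomialRing R
  open LeadingTerm R
  module A = CommutativeRing polyRing
  open CommutativeExp A.commutativeSemiring public
    using (^-congˡ; ^-congʳ; ^-homo-*; ^-assocʳ; ^-distrib-*)
  *-congˡ : ∀ P {Q S} → Q ≈ S → P * Q ≈ P * S
  *-congˡ P e = A.*-cong (A.refl {P}) e

  *-congʳ : ∀ P {Q S} → Q ≈ S → Q * P ≈ S * P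
  *-congʳ P e = A.*-cong e (A.refl {P})

  +-congˡ : ∀ P {Q S} → Q ≈ S → P + Q ≈ P + S
  +-congˡ P e = A.+-cong (A.refl {P}) e

  +-congʳ : ∀ P {Q S} → Q ≈ S → Q + P ≈ S + P
  +-congʳ P e = A.+-cong e (A.refl {P})

  module AP = RingProperties A.ring
  open SemiringSolver A.commutativeSemiring using (solve; _:+_; _:*_; _:=_)
  open SetoidReasoning A.setoid

  -- The length of a list is no degree, as trailing zeros are allowed. Deciding equality with zero
  -- from the top coefficient downwards produces a genuine one.
  zero⊎Lead : ∀ P → P ≈ 0ₚ ⊎ ∃₂ λ d l → ¬ l R.≈ R.0# × Lead P d l
  zero⊎Lead []      = inj₁ A.refl
  zero⊎Lead (a ∷ P) with zero⊎Lead P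
  ... | inj₂ (d , l , l≉0 , p) = inj₂ (suc d , l , l≉0 , mkLead (top p) λ { (suc n) (s≤s d<n) → above p n d<n })
  ... | inj₁ P≈0 with a ≟ R.0#
  ...   | yes a≈0 = inj₁ (mk≈ λ { zero → a≈0 ; (suc n) → coeff-≈ P≈0 n })
  ...   | no a≉0  = inj₂ (0 , a , a≉0 , mkLead R.refl λ { (suc n) _ → coeff-≈ P≈0 n })

  Lead-unique : ∀ {P d e l m} → ¬ l R.≈ R.0# → ¬ m R.≈ R.0# → Lead P d l → Lead P e m → d ≡ e × l R.≈ m
  Lead-unique {d = d} {e} l≉0 m≉0 p q with ℕ.<-cmp d e
  ... | tri< d<e _ _    = contradiction (R.trans (R.sym (top q)) (above p e d<e)) m≉0
  ... | tri≈ _ ≡.refl _ = ≡.refl , R.trans (R.sym (top p)) (top q)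
  ... | tri> _ _ e<d    = contradiction (R.trans (R.sym (top p)) (above q d e<d)) l≉0

  Lead-0 : ∀ {P d l} → P ≈ 0ₚ → Lead P d l → l R.≈ R.0#
  Lead-0 P≈0 p = R.trans (R.sym (top p)) (coeff-≈ P≈0 _)

  Lead-quotient : ∀ E D {S d s} → E * D ≈ S → Lead D d R.1# → Lead S s R.1# → ∃ λ e → Lead E e R.1# × e ℕ.+ d ≡ s
  Lead-quotient E D ED≈S D-monic S-monic with zero⊎Lead E
  ... | inj₁ E≈0 = contradiction (Lead-0 (A.trans (A.sym ED≈S) (A.trans (*-congʳ D E≈0) (A.zeroˡ D))) S-monic) 1≉0
  ... | inj₂ (e , l , l≉0 , E-lead) with Lead-unique (λ l≈0 → l≉0 (R.trans (R.sym (R.*-identityʳ l)) l≈0)) 1≉0 (Lead-resp ED≈S (Lead-* E-lead D-monic)) S-monic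
  ...   | e+d≡s , l≈1 = e , Lead-resp-≈ (R.trans (R.sym (R.*-identityʳ l)) l≈1) E-lead , e+d≡s

  Monic-1 : Monic 1ₚ
  Monic-1 = monic Lead-1

  Monic-resp : ∀ {P Q} → P ≈ Q → Monic P → Monic Q
  Monic-resp {P} e p = monic (Lead-resp e (proj₂ (monic⁻¹ {P} p)))

  Monic-* : ∀ {P Q} → Monic P → Monic Q → Monic (P * Q)
  Monic-* {P} {Q} p q = monic (Lead-resp-≈ (R.*-identityˡ _) (Lead-* (proj₂ (monic⁻¹ {P} p)) (proj₂ (monic⁻¹ {Q} q))))

  Monic-^ : ∀ {P} n → Monic P → Monic (P ^ n)
  Monic-^ {P} n p = monic (Lead-^ n (proj₂ (monic⁻¹ {P} p)))

  Monic-quotient : ∀ E D {S} → E * D ≈ S → Monic D → Monic S → Monic E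
  Monic-quotient E D {S} e d s with Lead-quotient E D e (proj₂ (monic⁻¹ {D} d)) (proj₂ (monic⁻¹ {S} s))
  ... | _ , E-monic , _ = monic E-monic

  private
    monic*≈0 : ∀ P Q → Monic P → P * Q ≈ 0ₚ → Q ≈ 0ₚ
    monic*≈0 P Q p PQ≈0 with zero⊎Lead Q
    ... | inj₁ Q≈0 = Q≈0
    ... | inj₂ (_ , l , l≉0 , q) =
      contradiction (R.trans (R.sym (R.*-identityˡ l)) (Lead-0 PQ≈0 (Lead-* (proj₂ (monic⁻¹ {P} p)) q))) l≉0

  monic-cancelˡ : ∀ P Q S → Monic P → P * Q ≈ P * S → Q ≈ S
  monic-cancelˡ P Q S p e = AP.x∙y⁻¹≈ε⇒x≈y Q S (monic*≈0 P (Q - S) p (begin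
    P * (Q - S)         ≈⟨ AP.x[y-z]≈xy-xz P Q S ⟩
    P * Q - P * S       ≈⟨ AP.x≈y⇒x∙y⁻¹≈ε e ⟩
    0ₚ                  ∎))

  -- A nonzero multiple of D has degree at least d. Its use is to force remainders modulo a binomial
  -- to vanish.
  monic-small⇒0 : ∀ {D S d} → Lead D d R.1# → D ∣ S → (∀ n → d ℕ.≤ n → coeff S n R.≈ R.0#) → S ≈ 0ₚ
  monic-small⇒0 {D} D-monic (E , ED≈S) small with zero⊎Lead E
  ... | inj₁ E≈0 = A.trans (A.sym ED≈S) (A.trans (*-congʳ D E≈0) (A.zeroˡ D))
  ... | inj₂ (e , l , l≉0 , E-lead) = contradiction
    (R.trans (R.sym (R.*-identityʳ l)) (R.trans (R.sym (top (Lead-resp ED≈S (Lead-* E-lead D-monic)))) (small _ (ℕ.m≤n+m _ e)))) l≉0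

  monic∣1 : ∀ {D} → Monic D → D ∣ 1ₚ → D ≈ 1ₚ
  monic∣1 {D} d (E , ED≈1) with Lead-quotient E D ED≈1 (proj₂ (monic⁻¹ {D} d)) Lead-1
  ... | e , _ , e+d≡0 with ≡.subst (λ k → Lead D k R.1#) (ℕ.m+n≡0⇒n≡0 e e+d≡0) (proj₂ (monic⁻¹ {D} d))
  ...   | D-lead = mk≈ λ { zero → top D-lead ; (suc n) → above D-lead (suc n) z<s }

  module _ (a : R.Carrier) where
    open Evaluation R R id id (λ _ _ → R.refl) (λ _ _ → R.refl) R.refl R.refl a public

  ∣-refl : ∀ {P} → P ∣ P
  ∣-refl {P} = 1ₚ , A.*-identityˡ P

  ∣-trans : ∀ {P Q S} → P ∣ Q → Q ∣ S → P ∣ S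
  ∣-trans {P} {Q} {S} (E , EP≈Q) (G , GQ≈S) = G * E , A.trans (A.*-assoc G E P) (A.trans (*-congˡ G EP≈Q) GQ≈S)

  ∣-respˡ : ∀ {P Q S} → P ≈ Q → P ∣ S → Q ∣ S
  ∣-respˡ e (E , f) = E , A.trans (*-congˡ E (A.sym e)) f

  ∣-respʳ : ∀ {P Q S} → Q ≈ S → P ∣ Q → P ∣ S
  ∣-respʳ e (E , f) = E , A.trans f e

  ∣-*ˡ : ∀ {P Q} S → P ∣ Q → P ∣ S * Q
  ∣-*ˡ {P} S (E , f) = S * E , A.trans (A.*-assoc S E P) (*-congˡ S f)

  ∣-*ʳ : ∀ {P Q} S → P ∣ Q → P ∣ Q * S
  ∣-*ʳ {P} {Q} S h = ∣-respʳ (A.*-comm S Q) (∣-*ˡ S h)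

  *-mono-∣ : ∀ {P P′ Q Q′} → P ∣ P′ → Q ∣ Q′ → P * Q ∣ P′ * Q′
  *-mono-∣ {P} {P′} {Q} {Q′} (E , f) (G , g) = E * G , A.trans
    (solve 4 (λ E G P Q → (E :* G) :* (P :* Q) := (E :* P) :* (G :* Q)) A.refl E G P Q) (A.*-cong f g)

  1∣ : ∀ P → 1ₚ ∣ P
  1∣ P = P , A.*-identityʳ P

  eval≉0-∣ : ∀ {a P Q} → P ∣ Q → ¬ eval a Q R.≈ R.0# → ¬ eval a P R.≈ R.0#
  eval≉0-∣ {a} {P} {Q} (E , EP≈Q) Q≉0 P≈0 = Q≉0 (R.trans (eval-cong a (A.sym EP≈Q))
    (R.trans (eval-* a E P) (R.trans (R.*-congˡ P≈0) (R.zeroʳ _))))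

  eval-*≉0 : ∀ a P Q → ¬ eval a P R.≈ R.0# → ¬ eval a Q R.≈ R.0# → ¬ eval a (P * Q) R.≈ R.0#
  eval-*≉0 a P Q p q e with integral (R.trans (R.sym (eval-* a P Q)) e)
  ... | inj₁ p≈0 = p p≈0
  ... | inj₂ q≈0 = q q≈0

  eval-*≈0 : ∀ a P Q {S} → P * Q ≈ S → eval a S R.≈ R.0# → eval a P R.≈ R.0# ⊎ eval a Q R.≈ R.0#
  eval-*≈0 a P Q e s = integral (R.trans (R.sym (eval-* a P Q)) (R.trans (eval-cong a e) s))

  opaque
    lin : R.Carrier → Poly
    lin a = X - C a

    lin≈ : ∀ a → lin a ≈ X - C a
    lin≈ a = A.refl

  lin-cong : ∀ {a b} → a R.≈ b → lin a ≈ lin b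
  lin-cong {a} {b} a≈b = A.trans (lin≈ a) (A.trans (+-congˡ X (A.-‿cong (C-cong a≈b))) (A.sym (lin≈ b)))

  Lead-lin : ∀ a → Lead (lin a) 1 R.1#
  Lead-lin a = Lead-resp (A.sym (lin≈ a)) (Lead-+ˡ {X} {A.- C a} Lead-X λ { (suc n) _ → R.refl })

  Monic-lin : ∀ a → Monic (lin a)
  Monic-lin a = monic (Lead-lin a)

  eval-lin : ∀ a b → eval a (lin b) R.≈ a R.- b
  eval-lin a b = R.trans (eval-cong a (lin≈ b)) (R.trans (eval-- a X (C b)) (R.+-cong (eval-X a) (R.-‿cong (eval-C a b))))

  eval-lin-self : ∀ a → eval a (lin a) R.≈ R.0#
  eval-lin-self a = R.trans (eval-lin a a) (R.-‿inverseʳ a)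

  eval-lin≈0⇒≈ : ∀ {a b} → eval a (lin b) R.≈ R.0# → a R.≈ b
  eval-lin≈0⇒≈ {a} {b} e = RingProperties.x∙y⁻¹≈ε⇒x≈y R.ring a b (R.trans (R.sym (eval-lin a b)) e)

  private
    X≈lin+C : ∀ a → X ≈ lin a + C a
    X≈lin+C a = A.sym (A.trans (+-congʳ (C a) (lin≈ a)) (A.trans (A.+-assoc X (- C a) (C a)) (A.trans (+-congˡ X (A.-‿inverseˡ (C a))) (A.+-identityʳ X))))

  -- Horner's scheme: if P = Q (x - a) + v, then b + x P has quotient v + x Q and remainder b + a v,
  -- which is the recursion of `eval`.
  division : ∀ a P → ∃ λ Q → P ≈ Q * lin a + C (eval a P)
  division a []      = [] , A.sym C-0
  division a (b ∷ P) with division a P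
  ... | Q , P≈ = C v + X * Q , (begin
    b ∷ P                                       ≈⟨ ∷≈C+X* b P ⟩
    C b + X * P                                 ≈⟨ +-congˡ (C b) (*-congˡ X P≈) ⟩
    C b + X * (Q * lin a + C v)                 ≈⟨ +-congˡ (C b) (A.distribˡ X (Q * lin a) (C v)) ⟩
    C b + (X * (Q * lin a) + X * C v)           ≈⟨ +-congˡ (C b) (+-congˡ (X * (Q * lin a)) (*-congʳ (C v) (X≈lin+C a))) ⟩
    C b + (X * (Q * lin a) + (lin a + C a) * C v) ≈⟨ solve 6 (λ b x q l a v → b :+ (x :* (q :* l) :+ (l :+ a) :* v) := (v :+ x :* q) :* l :+ (b :+ a :* v)) A.refl (C b) X Q (lin a) (C a) (C v) ⟩
    (C v + X * Q) * lin a + (C b + C a * C v)   ≈⟨ +-congˡ ((C v + X * Q) * lin a) (+-congˡ (C b) (A.sym (C-* a v))) ⟩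
    (C v + X * Q) * lin a + C (b R.+ a R.* v)   ∎)
    where v = eval a P

  root⇒lin∣ : ∀ {a P} → eval a P R.≈ R.0# → lin a ∣ P
  root⇒lin∣ {a} {P} e with division a P
  ... | Q , P≈ = Q , A.sym (A.trans P≈ (A.trans (+-congˡ (Q * lin a) (A.trans (C-cong e) C-0)) (A.+-identityʳ _)))

  lin∣⇒root : ∀ {a P} → lin a ∣ P → eval a P R.≈ R.0#
  lin∣⇒root {a} (Q , e) = R.trans (eval-cong a (A.sym e)) (R.trans (eval-* a Q (lin a)) (R.trans (R.*-congˡ (eval-lin-self a)) (R.zeroʳ _)))

  private
    rotate : ∀ L P Q → (P * Q) * L ≈ (L * P) * Q
    rotate = solve 3 (λ l p q → (p :* q) :* l := (l :* p) :* q) A.refl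

  eval-lin^≈0 : ∀ a n P → eval a (lin a ^ suc n * P) R.≈ R.0#
  eval-lin^≈0 a n P = lin∣⇒root (lin a ^ n * P , rotate (lin a) (lin a ^ n) P)

  -- The prime factor lin a of a factorisation is distributed over the two cofactors.
  record Split (a : R.Carrier) (m : ℕ) (E D S : Poly) : Set (c ⊔ ℓ) where
    field
      e f    : ℕ
      e+f≡m  : e ℕ.+ f ≡ m
      D₀ E₀  : Poly
      D≈     : D ≈ lin a ^ e * D₀
      E≈     : E ≈ lin a ^ f * E₀
      E₀D₀≈S : E₀ * D₀ ≈ S

  private
    rotate′ : ∀ {a D₁ D D₀} e → D₁ * lin a ≈ D → D₁ ≈ lin a ^ e * D₀ → D ≈ lin a ^ suc e * D₀
    rotate′ {a} {D₁} {D} {D₀} e D₁l≈D D₁≈ = begin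
      D                              ≈⟨ D₁l≈D ⟨
      D₁ * lin a                     ≈⟨ *-congʳ (lin a) D₁≈ ⟩
      (lin a ^ e * D₀) * lin a       ≈⟨ rotate (lin a) (lin a ^ e) D₀ ⟩
      (lin a * lin a ^ e) * D₀       ∎

    cancel-lin : ∀ a m E D {S} → lin a * (E * D) ≈ lin a ^ suc m * S → E * D ≈ lin a ^ m * S
    cancel-lin a m E D {S} e =
      monic-cancelˡ (lin a) (E * D) (lin a ^ m * S) (Monic-lin a) (A.trans e (A.*-assoc (lin a) (lin a ^ m) S))

    splitˡ : ∀ {a m E D D₁ S} → D₁ * lin a ≈ D → Split a m E D₁ S → Split a (suc m) E D S
    splitˡ D₁l≈D s = record
      { e = suc e ; f = f ; e+f≡m = ≡.cong suc e+f≡m ; D₀ = D₀ ; E₀ = E₀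
      ; D≈ = rotate′ e D₁l≈D D≈ ; E≈ = E≈ ; E₀D₀≈S = E₀D₀≈S }
      where open Split s

    splitʳ : ∀ {a m E E₁ D S} → E₁ * lin a ≈ E → Split a m E₁ D S → Split a (suc m) E D S
    splitʳ E₁l≈E s = record
      { e = e ; f = suc f ; e+f≡m = ≡.trans (ℕ.+-suc e f) (≡.cong suc e+f≡m) ; D₀ = D₀ ; E₀ = E₀
      ; D≈ = D≈ ; E≈ = rotate′ f E₁l≈E E≈ ; E₀D₀≈S = E₀D₀≈S }
      where open Split s

  -- As x - a is prime, a zero of E D at a is a zero of E or of D; one factor x - a is cancelled
  -- from that side and m decreases. The exponents e and f are the exact multiplicities only when S
  -- does not vanish at a.
  split : ∀ a m E D S → E * D ≈ lin a ^ m * S → Split a m E D S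
  split a zero E D S ED≈ = record
    { e = 0 ; f = 0 ; e+f≡m = ≡.refl ; D₀ = D ; E₀ = E
    ; D≈ = A.sym (A.*-identityˡ D) ; E≈ = A.sym (A.*-identityˡ E) ; E₀D₀≈S = A.trans ED≈ (A.*-identityˡ S) }
  split a (suc m) E D S ED≈ = case (eval-*≈0 a E D ED≈ (eval-lin^≈0 a m S))
    where
    case : eval a E R.≈ R.0# ⊎ eval a D R.≈ R.0# → Split a (suc m) E D S
    case (inj₁ E≈0) = let (E₁ , E₁l≈E) = root⇒lin∣ {a} {E} E≈0 in
      splitʳ E₁l≈E (split a m E₁ D S (cancel-lin a m E₁ D (begin
        lin a * (E₁ * D)        ≈⟨ solve 3 (λ l e d → l :* (e :* d) := (e :* l) :* d) A.refl (lin a) E₁ D ⟩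
        (E₁ * lin a) * D        ≈⟨ *-congʳ D E₁l≈E ⟩
        E * D                   ≈⟨ ED≈ ⟩
        lin a ^ suc m * S       ∎)))
    case (inj₂ D≈0) = let (D₁ , D₁l≈D) = root⇒lin∣ {a} {D} D≈0 in
      splitˡ D₁l≈D (split a m E D₁ S (cancel-lin a m E D₁ (begin
        lin a * (E * D₁)        ≈⟨ solve 3 (λ l e d → l :* (e :* d) := e :* (d :* l)) A.refl (lin a) E D₁ ⟩
        E * (D₁ * lin a)        ≈⟨ *-congˡ E D₁l≈D ⟩
        E * D                   ≈⟨ ED≈ ⟩
        lin a ^ suc m * S       ∎)))

  -- P has no factor x - a, so all m of them must lie in the cofactor.
  ∣lin^*⇒∣ : ∀ {a P} m Q → P ∣ lin a ^ m * Q → ¬ eval a P R.≈ R.0# → P ∣ Q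
  ∣lin^*⇒∣ {a} {P} m Q (E , EP≈) P≉0 with split a m E P Q EP≈
  ... | record { e = zero ; D₀ = D₀ ; E₀ = E₀ ; D≈ = P≈ ; E₀D₀≈S = f } =
    E₀ , A.trans (*-congˡ E₀ (A.trans P≈ (A.*-identityˡ D₀))) f
  ... | record { e = suc e ; D₀ = D₀ ; D≈ = P≈ } =
    contradiction (R.trans (eval-cong a P≈) (eval-lin^≈0 a e D₀)) P≉0

  -- The multiplicity of a root is well defined: factors x - a are cancelled on both sides until one
  -- exponent is 0, and a leftover on the other side would make P or Q vanish at a.
  lin^-cancel : ∀ a e f P Q → lin a ^ e * P ≈ lin a ^ f * Q → ¬ eval a P R.≈ R.0# → ¬ eval a Q R.≈ R.0# → e ≡ f
  lin^-cancel a zero zero P Q _ _ _ = ≡.refl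
  lin^-cancel a zero (suc f) P Q e p q = contradiction
    (R.trans (eval-cong a (A.trans (A.sym (A.*-identityˡ P)) e)) (eval-lin^≈0 a f Q)) p
  lin^-cancel a (suc e) zero P Q h p q = contradiction
    (R.trans (eval-cong a (A.trans (A.sym (A.*-identityˡ Q)) (A.sym h))) (eval-lin^≈0 a e P)) q
  lin^-cancel a (suc e) (suc f) P Q h p q = ≡.cong suc (lin^-cancel a e f P Q (monic-cancelˡ (lin a) (lin a ^ e * P) (lin a ^ f * Q) (Monic-lin a)
    (A.trans (A.sym (A.*-assoc (lin a) (lin a ^ e) P)) (A.trans h (A.*-assoc (lin a) (lin a ^ f) Q)))) p q)

-- Bi-unitary divisors of products of linear factors

module BiUnitary {c ℓ : Level} (R : CommutativeRing c ℓ) (isField : IsDecidableField R) where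

  private
    module R = CommutativeRing R

  open IsDecidableField isField
  open Polynomial R
  open RawMagmaDefs (RawRing.*-rawMagma polyRawRing) using (_,_)
  open PolynomialRing R
  open LinearFactors R isField
  open SemiringSolver A.commutativeSemiring using (solve; _:*_; _:=_)
  open SetoidReasoning A.setoid

  coprime : ∀ {S T} → (∀ C → Monic C → C ∣ S → C ∣ T → C ∣ 1ₚ) → IsGCD S T 1ₚ
  coprime {S} {T} h = record
    { monic = Monic-1 ; divides₁ = 1∣ S ; divides₂ = 1∣ T ; greatest = λ {D} → h D }

  IsUnitaryDivisor-resp : ∀ {D S T} → S ≈ T → IsUnitaryDivisor D S → IsUnitaryDivisor D T
  IsUnitaryDivisor-resp e (m , E , f , g) = m , E , A.trans f e , g

  1-unitary : ∀ S → IsUnitaryDivisor 1ₚ S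
  1-unitary S = Monic-1 , S , A.*-identityʳ S , coprime λ _ _ C∣1 _ → C∣1

  coprimeᵤ : ∀ {S T} → (∀ C → IsUnitaryDivisor C S → IsUnitaryDivisor C T → C ∣ 1ₚ) → IsGCDᵤ S T 1ₚ
  coprimeᵤ {S} {T} h = record { unitary₁ = 1-unitary S ; unitary₂ = 1-unitary T ; greatest = λ {D} → h D }

  IsBiUnitaryDivisor-respʳ : ∀ {D S T} → S ≈ T → IsBiUnitaryDivisor D S → IsBiUnitaryDivisor D T
  IsBiUnitaryDivisor-respʳ e (m , E , f , g) = m , E , A.trans f e , g

  IsBiUnitaryDivisor-respˡ : ∀ {D D′ S} → D ≈ D′ → IsBiUnitaryDivisor D S → IsBiUnitaryDivisor D′ S
  IsBiUnitaryDivisor-respˡ {D} {D′} e (m , E , f , g) = Monic-resp {D} {D′} e m , E , A.trans (*-congˡ E (A.sym e)) f ,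
    coprimeᵤ λ C u v → IsGCDᵤ.greatest g (IsUnitaryDivisor-resp (A.sym e) u) v

  private
    eval-1≉0 : ∀ {a} → ¬ eval a 1ₚ R.≈ R.0#
    eval-1≉0 {a} e = 1≉0 (R.trans (R.sym (eval-1 a)) e)

    lin∤1 : ∀ {a} → ¬ lin a ∣ 1ₚ
    lin∤1 h = eval-1≉0 (lin∣⇒root h)

    lin∣lin^suc* : ∀ a n P → lin a ∣ lin a ^ suc n * P
    lin∣lin^suc* a n P = ∣-*ʳ {lin a} P (∣-*ʳ {lin a} (lin a ^ n) ∣-refl)

    -- A common divisor of C and (x - a)^e E does not vanish at a, because C does not, and therefore
    -- already divides E.
    unitary-lin^* : ∀ {a e C S} → ¬ eval a S R.≈ R.0# → IsUnitaryDivisor C S → IsUnitaryDivisor C (lin a ^ e * S)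
    unitary-lin^* {a} {e} {C} {S} S≉0 (m , E , EC≈S , g) = m , lin a ^ e * E ,
      A.trans (A.*-assoc (lin a ^ e) E C) (*-congˡ (lin a ^ e) EC≈S) ,
      coprime λ B B-monic B∣C B∣ → IsGCD.greatest g B-monic B∣C
        (∣lin^*⇒∣ e E B∣ (eval≉0-∣ B∣C (eval≉0-∣ (E , EC≈S) S≉0)))

    lin^-unitary : ∀ {a e S} → ¬ eval a S R.≈ R.0# → IsUnitaryDivisor (lin a ^ e) (lin a ^ e * S)
    lin^-unitary {a} {e} {S} S≉0 = Monic-^ {lin a} e (Monic-lin a) , S , A.*-comm S (lin a ^ e) ,
      coprime λ B _ B∣lin^ B∣S →
        ∣lin^*⇒∣ e 1ₚ (∣-respʳ (A.sym (A.*-identityʳ (lin a ^ e))) B∣lin^) (eval≉0-∣ B∣S S≉0)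

    -- As C does not vanish at a, the whole power of x - a sits in its cofactor H; removing it
    -- leaves the cofactor of C in S, which can only have fewer divisors in common with C.
    unitary-lin^*⁻¹ : ∀ {a e C S} → ¬ eval a C R.≈ R.0# → IsUnitaryDivisor C (lin a ^ e * S) → IsUnitaryDivisor C S
    unitary-lin^*⁻¹ {a} {e} {C} {S} C≉0 (m , H , HC≈ , g) = m , case (split a e H C S HC≈)
      where
      case : Split a e H C S → ∃ λ E → E * C ≈ S × IsGCD C E 1ₚ
      case record { e = suc i ; D₀ = C₀ ; D≈ = C≈ } =
        contradiction (R.trans (eval-cong a C≈) (eval-lin^≈0 a i C₀)) C≉0
      case record { e = zero ; f = f ; D₀ = C₀ ; E₀ = H₀ ; D≈ = C≈ ; E≈ = H≈ ; E₀D₀≈S = q } =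
        H₀ , A.trans (*-congˡ H₀ (A.trans C≈ (A.*-identityˡ C₀))) q ,
        coprime λ B B-monic B∣C B∣H₀ → IsGCD.greatest g B-monic B∣C (∣-respʳ (A.sym H≈) (∣-*ˡ {B} (lin a ^ f) B∣H₀))

    -- A unitary divisor takes all of a prime power or nothing: if both C and its cofactor kept a
    -- factor x - a, that factor would divide their gcd 1.
    unitary-root : ∀ {a e C S} → ¬ eval a S R.≈ R.0# → eval a C R.≈ R.0# → IsUnitaryDivisor C (lin a ^ e * S) →
                   ∃ λ C₀ → C ≈ lin a ^ e * C₀ × ¬ eval a C₀ R.≈ R.0#
    unitary-root {a} {e} {C} {S} S≉0 C≈0 (m , H , HC≈ , g) = case (split a e H C S HC≈)
      where
      case : Split a e H C S → ∃ λ C₀ → C ≈ lin a ^ e * C₀ × ¬ eval a C₀ R.≈ R.0#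
      case record { e = zero ; D₀ = C₀ ; E₀ = H₀ ; D≈ = C≈ ; E₀D₀≈S = q } = contradiction
        (R.trans (eval-cong a (A.trans (A.sym (A.*-identityˡ C₀)) (A.sym C≈))) C≈0) (eval≉0-∣ (H₀ , q) S≉0)
      case record { e = suc i ; f = suc j ; D₀ = C₀ ; E₀ = H₀ ; D≈ = C≈ ; E≈ = H≈ } = contradiction
        (IsGCD.greatest g (Monic-lin a) (∣-respʳ (A.sym C≈) (lin∣lin^suc* a i C₀)) (∣-respʳ (A.sym H≈) (lin∣lin^suc* a j H₀)))
        lin∤1
      case record { e = suc i ; f = zero ; e+f≡m = e≡ ; D₀ = C₀ ; E₀ = H₀ ; D≈ = C≈ ; E₀D₀≈S = q } = C₀ ,
        ≡.subst (λ k → C ≈ lin a ^ k * C₀) (≡.trans (≡.sym (ℕ.+-identityʳ (suc i))) e≡) C≈ , eval≉0-∣ (H₀ , q) S≉0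

  record BiUnitarySplit (a : R.Carrier) (r : ℕ) (D S : Poly) : Set (c ⊔ ℓ) where
    field
      e           : ℕ
      D₀          : Poly
      e≤2r        : e ℕ.≤ 2 ℕ.* r
      e≢r         : ¬ e ≡ r
      D≈          : D ≈ lin a ^ e * D₀
      D₀-biunitary : IsBiUnitaryDivisor D₀ S

  private
    e+f≡2r⇒f≡r : ∀ {f} r → r ℕ.+ f ≡ 2 ℕ.* r → f ≡ r
    e+f≡2r⇒f≡r {f} r p = ≡.trans (ℕ.+-cancelˡ-≡ r f (r ℕ.+ 0) p) (ℕ.+-identityʳ r)

  -- Common unitary divisors of D₀ and E₀ remain common unitary divisors of D and E, since neither
  -- D₀ nor E₀ vanishes at a. So D₀ inherits bi-unitarity from D.
  biunitary-split : ∀ {a r D S} → 0 < r → ¬ eval a S R.≈ R.0# →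
                    IsBiUnitaryDivisor D (lin a ^ (2 ℕ.* r) * S) → BiUnitarySplit a r D S
  biunitary-split {a} {r} {D} {S} 0<r S≉0 (m , E , ED≈ , g) = case (split a (2 ℕ.* r) E D S ED≈)
    where
    case : Split a (2 ℕ.* r) E D S → BiUnitarySplit a r D S
    case record { e = e ; f = f ; e+f≡m = e+f≡2r ; D₀ = D₀ ; E₀ = E₀ ; D≈ = D≈ ; E≈ = E≈ ; E₀D₀≈S = q } = record
      { e = e ; D₀ = D₀ ; e≤2r = ≡.subst (e ℕ.≤_) e+f≡2r (ℕ.m≤m+n e f) ; e≢r = e≢r ; D≈ = D≈
      ; D₀-biunitary = Monic-quotient D₀ (lin a ^ e) {D} (A.trans (A.*-comm D₀ (lin a ^ e)) (A.sym D≈)) (Monic-^ {lin a} e (Monic-lin a)) m , E₀ , q ,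
          coprimeᵤ λ C u v → IsGCDᵤ.greatest g (IsUnitaryDivisor-resp (A.sym D≈) (unitary-lin^* {a} {e} {C} {D₀} D₀≉0 u))
                                               (IsUnitaryDivisor-resp (A.sym E≈) (unitary-lin^* {a} {f} {C} {E₀} E₀≉0 v)) }
      where
      D₀≉0 : ¬ eval a D₀ R.≈ R.0#
      D₀≉0 = eval≉0-∣ (E₀ , q) S≉0
      E₀≉0 : ¬ eval a E₀ R.≈ R.0#
      E₀≉0 = eval≉0-∣ (D₀ , A.trans (A.*-comm D₀ E₀) q) S≉0
      lin∣lin^ : ∀ {n} → 0 < n → lin a ∣ lin a ^ n
      lin∣lin^ {suc n} _ = ∣-*ʳ {lin a} (lin a ^ n) ∣-refl
      -- For e = r the cofactor has exponent r too, so (x - a)^r is a unitary divisor of both D and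
      -- E; it is not 1 because 0 < r.
      e≢r : ¬ e ≡ r
      e≢r ≡.refl = lin∤1 (∣-trans (lin∣lin^ 0<r) (IsGCDᵤ.greatest g
        (IsUnitaryDivisor-resp (A.sym D≈) (lin^-unitary {a} {e} {D₀} D₀≉0))
        (IsUnitaryDivisor-resp (A.sym (≡.subst (λ k → E ≈ lin a ^ k * E₀) (e+f≡2r⇒f≡r e e+f≡2r) E≈)) (lin^-unitary {a} {e} {E₀} E₀≉0))))

  -- A common unitary divisor that does not vanish at a is one of D and E already. One that does
  -- vanish contains exactly (x - a)^e and exactly (x - a)^(2r - e), which forces e = r.
  biunitary-lin^* : ∀ {a r e D S} → ¬ eval a S R.≈ R.0# → e ℕ.≤ 2 ℕ.* r → ¬ e ≡ r →
                    IsBiUnitaryDivisor D S → IsBiUnitaryDivisor (lin a ^ e * D) (lin a ^ (2 ℕ.* r) * S)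
  biunitary-lin^* {a} {r} {e} {D} {S} S≉0 e≤2r e≢r (m , E , ED≈S , g) =
    Monic-* {lin a ^ e} {D} (Monic-^ {lin a} e (Monic-lin a)) m , lin a ^ f * E ,
    (begin
      (lin a ^ f * E) * (lin a ^ e * D)   ≈⟨ solve 4 (λ u x v y → (u :* x) :* (v :* y) := (v :* u) :* (x :* y)) A.refl (lin a ^ f) E (lin a ^ e) D ⟩
      (lin a ^ e * lin a ^ f) * (E * D)   ≈⟨ A.*-cong (A.trans (A.sym (^-homo-* (lin a) e f)) (^-congʳ (lin a) e+f≡2r)) ED≈S ⟩
      lin a ^ (2 ℕ.* r) * S               ∎) ,
    coprimeᵤ greatest
    where
    f : ℕ
    f = 2 ℕ.* r ℕ.∸ e
    e+f≡2r : e ℕ.+ f ≡ 2 ℕ.* r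
    e+f≡2r = ℕ.m+[n∸m]≡n e≤2r
    D≉0 : ¬ eval a D R.≈ R.0#
    D≉0 = eval≉0-∣ (E , ED≈S) S≉0
    E≉0 : ¬ eval a E R.≈ R.0#
    E≉0 = eval≉0-∣ (D , A.trans (A.*-comm D E) ED≈S) S≉0
    e≢f : ¬ e ≡ f
    e≢f e≡f = e≢r (ℕ.*-cancelˡ-≡ e r 2 (≡.trans (≡.cong (e ℕ.+_) (≡.trans (ℕ.+-identityʳ e) e≡f)) e+f≡2r))
    greatest : ∀ C → IsUnitaryDivisor C (lin a ^ e * D) → IsUnitaryDivisor C (lin a ^ f * E) → C ∣ 1ₚ
    greatest C u v with eval a C ≟ R.0#
    ... | no C≉0  = IsGCDᵤ.greatest g (unitary-lin^*⁻¹ {a} {e} {C} {D} C≉0 u) (unitary-lin^*⁻¹ {a} {f} {C} {E} C≉0 v)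
    ... | yes C≈0 = let (P , C≈P , P≉0) = unitary-root {a} {e} {C} {D} D≉0 C≈0 u
                        (Q , C≈Q , Q≉0) = unitary-root {a} {f} {C} {E} E≉0 C≈0 v
                    in contradiction (lin^-cancel a e f P Q (A.trans (A.sym C≈P) C≈Q) P≉0 Q≉0) e≢f

  roots : List R.Carrier → Poly
  roots = foldr (λ a P → lin a * P) 1ₚ

  open Membership R.setoid using (_∉_) renaming (_∈_ to _∈ᵣ_)
  open UniqueSetoid R.setoid using () renaming (Unique to Uniqueᵣ)
  open Membership polySetoid using (_∈_)
  open UniqueSetoid polySetoid using (Unique)

  eval-roots≉0 : ∀ {a} as → a ∉ as → ¬ eval a (roots as) R.≈ R.0#
  eval-roots≉0 []       a∉ = eval-1≉0
  eval-roots≉0 {a} (b ∷ as) a∉ = eval-*≉0 a (lin b) (roots as) (λ e → a∉ (here (eval-lin≈0⇒≈ e))) (eval-roots≉0 as (a∉ ∘ there))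

  eval-^≉0 : ∀ {a P} n → ¬ eval a P R.≈ R.0# → ¬ eval a (P ^ n) R.≈ R.0#
  eval-^≉0 zero    p = eval-1≉0
  eval-^≉0 {a} {P} (suc n) p = eval-*≉0 a P (P ^ n) p (eval-^≉0 {a} {P} n p)

  1^≈1 : ∀ n → 1ₚ ^ n ≈ 1ₚ
  1^≈1 zero    = A.refl
  1^≈1 (suc n) = A.trans (A.*-identityˡ _) (1^≈1 n)

  sum : List Poly → Poly
  sum = foldr _+_ 0ₚ

  powerSum : List ℕ → Poly → Poly
  powerSum es P = foldr (λ e S → P ^ e + S) 0ₚ es

  module _ (r : ℕ) (0<r : 0 < r) (exps : List ℕ) (exps! : Uniqueₙ exps)
           (exps-spec : ∀ {e} → e ∈ₙ exps ⇔ (e ℕ.≤ 2 ℕ.* r × ¬ e ≡ r)) where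

    biunitaryDivisors : List R.Carrier → List Poly
    biunitaryDivisors []       = 1ₚ ∷ []
    biunitaryDivisors (a ∷ as) = cartesianProductWith (λ e D → lin a ^ e * D) exps (biunitaryDivisors as)

    private
      roots^-∷ : ∀ a as → roots (a ∷ as) ^ (2 ℕ.* r) ≈ lin a ^ (2 ℕ.* r) * roots as ^ (2 ℕ.* r)
      roots^-∷ a as = ^-distrib-* (lin a) (roots as) (2 ℕ.* r)

      ≉0 : ∀ a as → Uniqueᵣ (a ∷ as) → ¬ eval a (roots as ^ (2 ℕ.* r)) R.≈ R.0#
      ≉0 a as (a∉ ∷ _) = eval-^≉0 {a} {roots as} (2 ℕ.* r) (eval-roots≉0 as (MembershipP.All[≉]⇒∉ R.setoid a∉))

    ∈⇒biunitary : ∀ as → Uniqueᵣ as → ∀ {D} → D ∈ biunitaryDivisors as → IsBiUnitaryDivisor D (roots as ^ (2 ℕ.* r))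
    ∈⇒biunitary [] _ {D} (here D≈1) = IsBiUnitaryDivisor-respˡ {1ₚ} {D} {1ₚ ^ (2 ℕ.* r)} (A.sym D≈1)
      (Monic-1 , 1ₚ ^ (2 ℕ.* r) , A.*-identityʳ _ ,
        coprimeᵤ λ { C (_ , E , EC≈1 , _) _ → E , EC≈1 })
    ∈⇒biunitary (a ∷ as) as!@(_ ∷ as!′) {D} D∈
      with MembershipP.∈-cartesianProductWith⁻ (≡.setoid ℕ) polySetoid polySetoid (λ e D → lin a ^ e * D) exps (biunitaryDivisors as) D∈
    ... | e , D₀ , e∈ , D₀∈ , D≈ =
      IsBiUnitaryDivisor-respˡ {lin a ^ e * D₀} {D} {roots (a ∷ as) ^ (2 ℕ.* r)} (A.sym D≈)
        (IsBiUnitaryDivisor-respʳ {lin a ^ e * D₀} (A.sym (roots^-∷ a as))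
          (biunitary-lin^* {a} {r} {e} {D₀} {roots as ^ (2 ℕ.* r)} (≉0 a as as!) (proj₁ e-spec) (proj₂ e-spec) (∈⇒biunitary as as!′ D₀∈)))
      where
      e-spec : e ℕ.≤ 2 ℕ.* r × ¬ e ≡ r
      e-spec = Equivalence.to exps-spec e∈

    biunitary⇒∈ : ∀ as → Uniqueᵣ as → ∀ {D} → IsBiUnitaryDivisor D (roots as ^ (2 ℕ.* r)) → D ∈ biunitaryDivisors as
    biunitary⇒∈ [] _ {D} (m , E , ED≈ , _) = here (monic∣1 {D} m (E , A.trans ED≈ (1^≈1 (2 ℕ.* r))))
    biunitary⇒∈ (a ∷ as) as!@(_ ∷ as!′) {D} b = MembershipP.∈-resp-≈ polySetoid (A.sym D≈)
      (MembershipP.∈-cartesianProductWith⁺ (≡.setoid ℕ) polySetoid polySetoid (λ { {x} ≡.refl q → *-congˡ (lin a ^ x) q })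
        (Equivalence.from exps-spec (e≤2r , e≢r)) (biunitary⇒∈ as as!′ D₀-biunitary))
      where
      open BiUnitarySplit (biunitary-split {a} {r} {D} {roots as ^ (2 ℕ.* r)} 0<r (≉0 a as as!)
        (IsBiUnitaryDivisor-respʳ {D} (roots^-∷ a as) b))

    private
      -- No D in `Ds` vanishes at a, so e is recovered from the product as its multiplicity at a,
      -- and then D by cancellation.
      Unique-× : ∀ a es Ds → Uniqueₙ es → Unique Ds → (∀ {D} → D ∈ Ds → ¬ eval a D R.≈ R.0#) →
                 Unique (cartesianProductWith (λ e D → lin a ^ e * D) es Ds)
      Unique-× a []       Ds _ _ _ = []
      Unique-× a (e ∷ es) Ds (e∉ ∷ es!) Ds! Ds≉0 = UniqueP.++⁺ polySetoid
        (UniqueP.map⁺ polySetoid polySetoid (λ {P} {Q} → monic-cancelˡ (lin a ^ e) P Q (Monic-^ {lin a} e (Monic-lin a))) Ds!)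
        (Unique-× a es Ds es! Ds! Ds≉0) disjoint
        where
        disjoint : ∀ {P} → ¬ (P ∈ map (lin a ^ e *_) Ds × P ∈ cartesianProductWith (λ e D → lin a ^ e * D) es Ds)
        disjoint (P∈ , P∈′)
          with MembershipP.∈-map⁻ polySetoid polySetoid P∈
             | MembershipP.∈-cartesianProductWith⁻ (≡.setoid ℕ) polySetoid polySetoid (λ e D → lin a ^ e * D) es Ds P∈′
        ... | D , D∈ , P≈ | e′ , D′ , e′∈ , D′∈ , P≈′ = All.lookup e∉ e′∈
          (lin^-cancel a e e′ D D′ (A.trans (A.sym P≈) P≈′) (Ds≉0 D∈) (Ds≉0 D′∈))

    biunitaryDivisors! : ∀ as → Uniqueᵣ as → Unique (biunitaryDivisors as)
    biunitaryDivisors! []       _ = [] ∷ []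
    biunitaryDivisors! (a ∷ as) as!@(_ ∷ as!′) = Unique-× a exps (biunitaryDivisors as) exps! (biunitaryDivisors! as as!′) D≉0
      where
      D≉0 : ∀ {D} → D ∈ biunitaryDivisors as → ¬ eval a D R.≈ R.0#
      D≉0 D∈ with ∈⇒biunitary as as!′ D∈
      ... | _ , E , ED≈ , _ = eval≉0-∣ (E , ED≈) (≉0 a as as!)

    private
      sum-++ : ∀ Ps Qs → sum (Ps ++ Qs) ≈ sum Ps + sum Qs
      sum-++ []       Qs = A.refl
      sum-++ (P ∷ Ps) Qs = A.trans (+-congˡ P (sum-++ Ps Qs)) (A.sym (A.+-assoc P (sum Ps) (sum Qs)))

      sum-map-* : ∀ P Ds → sum (map (P *_) Ds) ≈ P * sum Ds
      sum-map-* P []       = A.sym (A.zeroʳ P)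
      sum-map-* P (D ∷ Ds) = A.trans (+-congˡ (P * D) (sum-map-* P Ds)) (A.sym (A.distribˡ P D (sum Ds)))

      sum-× : ∀ P es Ds → sum (cartesianProductWith (λ e D → P ^ e * D) es Ds) ≈ powerSum es P * sum Ds
      sum-× P []       Ds = A.refl
      sum-× P (e ∷ es) Ds = begin
        sum (map (P ^ e *_) Ds ++ rest)               ≈⟨ sum-++ (map (P ^ e *_) Ds) rest ⟩
        sum (map (P ^ e *_) Ds) + sum rest            ≈⟨ A.+-cong (sum-map-* (P ^ e) Ds) (sum-× P es Ds) ⟩
        P ^ e * sum Ds + powerSum es P * sum Ds       ≈⟨ A.distribʳ (sum Ds) (P ^ e) (powerSum es P) ⟨
        (P ^ e + powerSum es P) * sum Ds              ∎
        where
        rest : List Poly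
        rest = cartesianProductWith (λ e D → P ^ e * D) es Ds

    -- Multiplicativity of σ** over distinct linear factors: expanding the product of the local sums
    -- lists every choice of exponents once.
    sum-biunitaryDivisors : ∀ as → sum (biunitaryDivisors as) ≈ foldr (λ a S → powerSum exps (lin a) * S) 1ₚ as
    sum-biunitaryDivisors []       = A.+-identityʳ 1ₚ
    sum-biunitaryDivisors (a ∷ as) = A.trans (sum-× (lin a) exps (biunitaryDivisors as)) (*-congˡ (powerSum exps (lin a)) (sum-biunitaryDivisors as))

-- Duplicate-free lists with the same elements

module _ {c ℓ : Level} (S : Setoid c ℓ) where

  private
    module S = Setoid S
  open Membership S using (_∈_)
  open UniqueSetoid S using (Unique)
  open Permutation S using (_↭_; ↭-refl; ↭-sym; ↭-trans; ↭-prep; ↭-reflexive-≋)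
  open PermutationP S using (shift; Unique-resp-↭; ∈-resp-↭)

  -- A sum or product over a commutative monoid thus depends only on the set that is listed. The
  -- uniqueness of σ** and every reindexing over the field rest on this.
  Unique-⊆⊇⇒↭ : ∀ {xs ys} → Unique xs → Unique ys →
                (∀ {x} → x ∈ xs → x ∈ ys) → (∀ {x} → x ∈ ys → x ∈ xs) → xs ↭ ys
  Unique-⊆⊇⇒↭ {[]}     {[]}     _ _ _ _ = ↭-refl
  Unique-⊆⊇⇒↭ {[]}     {y ∷ ys} _ _ _ ys⊆ = contradiction (ys⊆ (here S.refl)) λ ()
  Unique-⊆⊇⇒↭ {x ∷ xs} {ys} xs!@(_ ∷ xs!′) ys! xs⊆ ys⊆ with MembershipP.∈-∃++ S (xs⊆ (here S.refl))
  ... | as , bs , w , x≈w , ys≋ = ↭-trans (↭-prep x rest) (↭-sym ys↭)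
    where
    ys↭ : ys ↭ x ∷ as ++ bs
    ys↭ = ↭-trans (↭-reflexive-≋ ys≋) (shift (S.sym x≈w) as bs)
    ys!′ : Unique (x ∷ as ++ bs)
    ys!′ = Unique-resp-↭ ys↭ ys!
    tail⁻ : ∀ {z zs} → z ∈ x ∷ zs → ¬ z S.≈ x → z ∈ zs
    tail⁻ (here z≈x)  z≉x = contradiction z≈x z≉x
    tail⁻ (there z∈)  _   = z∈
    ∉-head : ∀ {z zs} → Unique (x ∷ zs) → z ∈ zs → ¬ z S.≈ x
    ∉-head (x∉ ∷ _) z∈ z≈x = MembershipP.All[≉]⇒∉ S x∉ (MembershipP.∈-resp-≈ S z≈x z∈)
    rest : xs ↭ as ++ bs
    rest with ys!′
    ... | _ ∷ ys!″ = Unique-⊆⊇⇒↭ xs!′ ys!″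
      (λ z∈ → tail⁻ (∈-resp-↭ ys↭ (xs⊆ (there z∈))) (∉-head xs! z∈))
      (λ z∈ → tail⁻ (ys⊆ (∈-resp-↭ (↭-sym ys↭) (there z∈))) (∉-head ys!′ z∈))

-- Finite fields

module FiniteField {c ℓ : Level} (R : CommutativeRing c ℓ) (isField : IsDecidableField R)
  (els : List (CommutativeRing.Carrier R))
  (els! : UniqueSetoid.Unique (CommutativeRing.setoid R) els)
  (complete : ∀ a → Membership._∈_ (CommutativeRing.setoid R) a els)
  (1<q : 1 < length els) where

  private
    module R = CommutativeRing R
    module RP = RingProperties R.ring

  open IsDecidableField isField
  open Polynomial R
  open RawMagmaDefs (RawRing.*-rawMagma polyRawRing) using (_,_)
  open PolynomialRing R
  open LeadingTerm R
  open LinearFactors R isField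
  open BiUnitary R isField
  open Exp R.semiring using () renaming (_^_ to _^ᵣ_)
  open Mult R.semiring using () renaming (_×_ to _×ᵣ_)
  open SemiringSolver A.commutativeSemiring using (solve; _:+_; _:*_; _:=_)
  open Membership R.setoid using (_∈_)
  open UniqueSetoid R.setoid using (Unique)
  open Permutation R.setoid using (_↭_; ↭-sym)
  module ≈ᵣ = SetoidReasoning R.setoid

  q : ℕ
  q = length els

  -- Any other enumeration of the bi-unitary divisors is a permutation of `Ds` and has the same sum,
  -- so σ** may be computed from one explicit list.
  σ**-unique : ∀ {S T Ds} → UniqueSetoid.Unique polySetoid Ds →
               (∀ {D} → Membership._∈_ polySetoid D Ds → IsBiUnitaryDivisor D S) →
               (∀ {D} → IsBiUnitaryDivisor D S → Membership._∈_ polySetoid D Ds) →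
               IsSigma** S T ⇔ (foldr _+_ 0ₚ Ds ≈ T)
  σ**-unique {S} {T} {Ds} Ds! sound complete′ = mk⇔ to from
    where
    to : IsSigma** S T → foldr _+_ 0ₚ Ds ≈ T
    to σ = A.trans (PermutationP.foldr-commMonoid polySetoid A.+-isCommutativeMonoid
        (Unique-⊆⊇⇒↭ polySetoid Ds! (IsSigma**.unique σ)
          (λ D∈ → Equivalence.from (IsSigma**.enumerates σ) (sound D∈))
          (λ D∈ → complete′ (Equivalence.to (IsSigma**.enumerates σ) D∈))))
      (IsSigma**.sum≈ σ)
    from : foldr _+_ 0ₚ Ds ≈ T → IsSigma** S T
    from e = record { divisors = Ds ; unique = Ds! ; enumerates = mk⇔ sound complete′ ; sum≈ = e }

  private
    ↭-complete : ∀ {as} → Unique as → (∀ a → a ∈ as) → els ↭ as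
    ↭-complete as! as-complete = Unique-⊆⊇⇒↭ R.setoid els! as! (λ _ → as-complete _) (λ _ → complete _)

  translate-↭ : ∀ c → els ↭ map (R._+ c) els
  translate-↭ c = ↭-complete (UniqueP.map⁺ R.setoid R.setoid (RP.+-cancelʳ c _ _) els!)
    λ a → MembershipP.∈-resp-≈ R.setoid (a-c+c≈a a) (MembershipP.∈-map⁺ R.setoid R.setoid R.+-congʳ (complete (a R.- c)))
    where
    a-c+c≈a : ∀ a → (a R.- c) R.+ c R.≈ a
    a-c+c≈a a = R.trans (R.+-assoc a (R.- c) c) (R.trans (R.+-congˡ (R.-‿inverseˡ c)) (R.+-identityʳ a))

  private
    sumᵣ prodᵣ : List R.Carrier → R.Carrier
    sumᵣ = foldr R._+_ R.0#
    prodᵣ = foldr R._*_ R.1#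

    sumᵣ-+1 : ∀ as → sumᵣ (map (R._+ R.1#) as) R.≈ length as ×ᵣ R.1# R.+ sumᵣ as
    sumᵣ-+1 []       = R.sym (R.+-identityˡ R.0#)
    sumᵣ-+1 (a ∷ as) = begin
      (a R.+ R.1#) R.+ sumᵣ (map (R._+ R.1#) as)            ≈⟨ R.+-congˡ (sumᵣ-+1 as) ⟩
      (a R.+ R.1#) R.+ (length as ×ᵣ R.1# R.+ sumᵣ as)       ≈⟨ RS.solve 4 (λ a o n s → (a RS.:+ o) RS.:+ (n RS.:+ s) RS.:= (o RS.:+ n) RS.:+ (a RS.:+ s)) R.refl a R.1# (length as ×ᵣ R.1#) (sumᵣ as) ⟩
      (R.1# R.+ length as ×ᵣ R.1#) R.+ (a R.+ sumᵣ as)       ∎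
      where
      open ≈ᵣ
      module RS = SemiringSolver R.commutativeSemiring

    prodᵣ-* : ∀ a as → prodᵣ (map (a R.*_) as) R.≈ a ^ᵣ length as R.* prodᵣ as
    prodᵣ-* a []       = R.sym (R.*-identityˡ R.1#)
    prodᵣ-* a (b ∷ as) = begin
      (a R.* b) R.* prodᵣ (map (a R.*_) as)                ≈⟨ R.*-congˡ (prodᵣ-* a as) ⟩
      (a R.* b) R.* (a ^ᵣ length as R.* prodᵣ as)          ≈⟨ RS.solve 4 (λ a b n s → (a RS.:* b) RS.:* (n RS.:* s) RS.:= (a RS.:* n) RS.:* (b RS.:* s)) R.refl a b (a ^ᵣ length as) (prodᵣ as) ⟩
      (a R.* a ^ᵣ length as) R.* (b R.* prodᵣ as)          ∎
      where
      open ≈ᵣ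
      module RS = SemiringSolver R.commutativeSemiring

  *-cancelˡ : ∀ {a b c} → ¬ a R.≈ R.0# → a R.* b R.≈ a R.* c → b R.≈ c
  *-cancelˡ {a} {b} {c} a≉0 e with integral {a} {b R.- c} (R.trans (RP.x[y-z]≈xy-xz a b c) (RP.x≈y⇒x∙y⁻¹≈ε e))
  ... | inj₁ a≈0 = contradiction a≈0 a≉0
  ... | inj₂ d   = RP.x∙y⁻¹≈ε⇒x≈y b c d

  -- Translation by 1 permutes the field, so the sum s of all elements satisfies q·1 + s = s.
  q×1≈0 : q ×ᵣ R.1# R.≈ R.0#
  q×1≈0 = RP.+-identityˡ-unique (q ×ᵣ R.1#) (sumᵣ els) (R.trans (R.sym (sumᵣ-+1 els))
    (R.sym (PermutationP.foldr-commMonoid R.setoid R.+-isCommutativeMonoid (translate-↭ R.1#))))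

  private
    nonzero : List R.Carrier
    nonzero = filter (λ a → ¬? (a ≟ R.0#)) els

    ≉0-resp : ∀ {a b} → a R.≈ b → ¬ a R.≈ R.0# → ¬ b R.≈ R.0#
    ≉0-resp e a≉0 b≈0 = a≉0 (R.trans e b≈0)

    ∈-nonzero⁺ : ∀ {a} → ¬ a R.≈ R.0# → a ∈ nonzero
    ∈-nonzero⁺ = MembershipP.∈-filter⁺ R.setoid (λ a → ¬? (a ≟ R.0#)) ≉0-resp (complete _)

    ∈-nonzero⁻ : ∀ {a} → a ∈ nonzero → ¬ a R.≈ R.0#
    ∈-nonzero⁻ = proj₂ ∘ MembershipP.∈-filter⁻ R.setoid (λ a → ¬? (a ≟ R.0#)) ≉0-resp {xs = els}

    nonzero! : Unique nonzero
    nonzero! = UniqueP.filter⁺ R.setoid (λ a → ¬? (a ≟ R.0#)) els!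

    els↭ : els ↭ R.0# ∷ nonzero
    els↭ = ↭-complete (MembershipP.∉⇒All[≉] R.setoid (λ 0∈ → ∈-nonzero⁻ 0∈ R.refl) ∷ nonzero!) split0
      where
      split0 : ∀ a → a ∈ R.0# ∷ nonzero
      split0 a with a ≟ R.0#
      ... | yes a≈0 = here a≈0
      ... | no a≉0  = there (∈-nonzero⁺ a≉0)

    prodᵣ≉0 : ∀ as → (∀ {a} → a ∈ as → ¬ a R.≈ R.0#) → ¬ prodᵣ as R.≈ R.0#
    prodᵣ≉0 []       h e = 1≉0 e
    prodᵣ≉0 (a ∷ as) h e with integral e
    ... | inj₁ a≈0 = h (here R.refl) a≈0
    ... | inj₂ e′  = prodᵣ≉0 as (h ∘ there) e′

    q≡ : q ≡ suc (length nonzero)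
    q≡ = PermutationP.xs↭ys⇒|xs|≡|ys| R.setoid els↭

    scale-↭ : ∀ {a} → ¬ a R.≈ R.0# → map (a R.*_) nonzero ↭ nonzero
    scale-↭ {a} a≉0 = Unique-⊆⊇⇒↭ R.setoid (UniqueP.map⁺ R.setoid R.setoid (*-cancelˡ a≉0) nonzero!) nonzero! sub sup
      where
      sub : ∀ {b} → b ∈ map (a R.*_) nonzero → b ∈ nonzero
      sub b∈ with MembershipP.∈-map⁻ R.setoid R.setoid b∈
      ... | d , d∈ , b≈ = ∈-nonzero⁺ λ b≈0 → h (integral (R.trans (R.sym b≈) b≈0))
        where
        h : a R.≈ R.0# ⊎ d R.≈ R.0# → _
        h (inj₁ a≈0) = a≉0 a≈0
        h (inj₂ d≈0) = ∈-nonzero⁻ d∈ d≈0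
      sup : ∀ {b} → b ∈ nonzero → b ∈ map (a R.*_) nonzero
      sup {b} b∈ with inverse a≉0
      ... | a⁻¹ , a⁻¹a≈1 = MembershipP.∈-resp-≈ R.setoid a[a⁻¹b]≈b
        (MembershipP.∈-map⁺ R.setoid R.setoid R.*-congˡ (∈-nonzero⁺ λ a⁻¹b≈0 → ∈-nonzero⁻ b∈
          (R.trans (R.sym a[a⁻¹b]≈b) (R.trans (R.*-congˡ a⁻¹b≈0) (R.zeroʳ a)))))
        where
        a[a⁻¹b]≈b : a R.* (a⁻¹ R.* b) R.≈ b
        a[a⁻¹b]≈b = R.trans (R.sym (R.*-assoc a a⁻¹ b)) (R.trans (R.*-congʳ (R.trans (R.*-comm a a⁻¹) a⁻¹a≈1)) (R.*-identityˡ b))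

  -- Multiplication by a ≠ 0 permutes the nonzero elements, so their product, itself nonzero, is
  -- unchanged by the factor a^(q-1).
  ^q≈ : ∀ a → a ^ᵣ q R.≈ a
  ^q≈ a rewrite q≡ with a ≟ R.0#
  ... | yes a≈0 = R.trans (R.*-congʳ a≈0) (R.trans (R.zeroˡ _) (R.sym a≈0))
  ... | no a≉0  = R.trans (R.*-congˡ a^|nonzero|≈1) (R.*-identityʳ a)
    where
    a^|nonzero|≈1 : a ^ᵣ length nonzero R.≈ R.1#
    a^|nonzero|≈1 = *-cancelˡ {prodᵣ nonzero} (prodᵣ≉0 nonzero ∈-nonzero⁻)
      (R.trans (R.*-comm _ _) (R.trans (R.sym (prodᵣ-* a nonzero))
        (R.trans (PermutationP.foldr-commMonoid R.setoid R.*-isCommutativeMonoid (scale-↭ a≉0)) (R.sym (R.*-identityʳ _)))))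

  roots-cong-↭ : ∀ {as bs} → as ↭ bs → roots as ≈ roots bs
  roots-cong-↭ {as} {bs} as↭bs = A.trans (roots≈prod as) (A.trans
    (PermutationP.foldr-commMonoid polySetoid A.*-isCommutativeMonoid (PermutationP.map⁺ R.setoid polySetoid lin-cong as↭bs))
    (A.sym (roots≈prod bs)))
    where
    roots≈prod : ∀ as → roots as ≈ foldr _*_ 1ₚ (map lin as)
    roots≈prod []       = A.refl
    roots≈prod (a ∷ as) = *-congˡ (lin a) (roots≈prod as)

  -- After division by x - a the remaining elements are still roots of the quotient, because they
  -- differ from a.
  roots∣ : ∀ {as} P → Unique as → (∀ {a} → a ∈ as → eval a P R.≈ R.0#) → roots as ∣ P
  roots∣ {[]}     P _          _ = 1∣ P
  roots∣ {a ∷ as} P (a∉ ∷ as!) h = let (Q , Qa≈P) = root⇒lin∣ {a} {P} (h (here R.refl)) in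
    ∣-respʳ (A.trans (A.*-comm (lin a) Q) Qa≈P) (*-mono-∣ {lin a} {lin a} {roots as} {Q} ∣-refl (roots∣ Q as! (root-Q Q Qa≈P)))
    where
    root-Q : ∀ Q → Q * lin a ≈ P → ∀ {b} → b ∈ as → eval b Q R.≈ R.0#
    root-Q Q Qa≈P {b} b∈ with eval-*≈0 b Q (lin a) Qa≈P (h (there b∈))
    ... | inj₁ Q≈0 = Q≈0
    ... | inj₂ l≈0 = contradiction (MembershipP.∈-resp-≈ R.setoid (eval-lin≈0⇒≈ l≈0) b∈) (MembershipP.All[≉]⇒∉ R.setoid a∉)

  Lead-roots : ∀ as → Lead (roots as) (length as) R.1#
  Lead-roots []       = Lead-1
  Lead-roots (a ∷ as) = Lead-resp-≈ (R.*-identityˡ R.1#) (Lead-* (Lead-lin a) (Lead-roots as))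

  -- By `^q≈` every field element is a root of the left side, so the product divides it; both are
  -- monic of degree q, and the quotient is 1. That 1 < q keeps -x below the leading term.
  X^q-X≈roots : X ^ q - X ≈ roots els
  X^q-X≈roots = let (E , E*roots≈) = roots∣ {els} (X ^ q - X) els! (λ {a} _ → eval≈0 a)
                    (e , E-lead , e+q≡q) = Lead-quotient E (roots els) E*roots≈ (Lead-roots els) lead
                in A.trans (A.sym E*roots≈) (A.trans (*-congʳ (roots els) (const E (≡.subst (λ k → Lead E k R.1#) (ℕ.+-cancelʳ-≡ q e 0 e+q≡q) E-lead))) (A.*-identityˡ (roots els)))
    where
    eval≈0 : ∀ a → eval a (X ^ q - X) R.≈ R.0#
    eval≈0 a = R.trans (eval-- a (X ^ q) X) (RP.x≈y⇒x∙y⁻¹≈ε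
      (R.trans (eval-^ a X q) (R.trans (Exp.^-congˡ R.semiring q (eval-X a)) (R.trans (^q≈ a) (R.sym (eval-X a))))))
    lead : Lead (X ^ q - X) q R.1#
    lead = Lead-+ˡ {X ^ q} {A.- X} (Lead-X^ q) λ n q≤n → R.trans (coeff-neg X n)
      (R.trans (R.-‿cong (above Lead-X n (ℕ.<-≤-trans 1<q q≤n))) RP.-0#≈0#)
    const : ∀ E → Lead E 0 R.1# → E ≈ 1ₚ
    const E E-lead = mk≈ λ { zero → top E-lead ; (suc n) → above E-lead (suc n) z<s }

  roots-translate : ∀ c → roots (map (R._+ c) els) ≈ roots els
  roots-translate c = roots-cong-↭ (↭-sym (translate-↭ c))

  private
    -- Each a in turn contributes to L as many copies of itself as `split` extracts factors x - a
    -- from D.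
    ∣roots^⇒roots-on : ∀ as m D → Monic D → D ∣ roots as ^ m → ∃ λ L → D ≈ roots L
    ∣roots^⇒roots-on []       m D D-monic D∣ = [] , monic∣1 {D} D-monic (∣-respʳ (1^≈1 m) D∣)
    ∣roots^⇒roots-on (a ∷ as) m D D-monic (E , ED≈) =
      case (split a m E D (roots as ^ m) (A.trans ED≈ (^-distrib-* (lin a) (roots as) m)))
      where
      case : Split a m E D (roots as ^ m) → ∃ λ L → D ≈ roots L
      case record { e = e ; D₀ = D₀ ; E₀ = E₀ ; D≈ = D≈ ; E₀D₀≈S = q } =
        let (L , D₀≈) = ∣roots^⇒roots-on as m D₀ (Monic-quotient D₀ (lin a ^ e) {D} (A.trans (A.*-comm D₀ (lin a ^ e)) (A.sym D≈))
                          (Monic-^ {lin a} e (Monic-lin a)) D-monic) (E₀ , q)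
        in prepend e L , A.trans D≈ (A.trans (*-congˡ (lin a ^ e) D₀≈) (prepend≈ e L))
        where
        prepend : ℕ → List R.Carrier → List R.Carrier
        prepend zero    L = L
        prepend (suc n) L = a ∷ prepend n L
        prepend≈ : ∀ n L → lin a ^ n * roots L ≈ roots (prepend n L)
        prepend≈ zero    L = A.*-identityˡ (roots L)
        prepend≈ (suc n) L = A.trans (A.*-assoc (lin a) (lin a ^ n) (roots L)) (*-congˡ (lin a) (prepend≈ n L))

  ∣roots^⇒roots : ∀ m D → Monic D → D ∣ roots els ^ m → ∃ λ L → D ≈ roots L
  ∣roots^⇒roots = ∣roots^⇒roots-on els

  private
    -- An exponent of 2 or more at a would exhibit (x - a)² as a divisor of D, so each extracted
    -- power divides the single factor x - a.
    squarefree∣roots-on : ∀ as m D → Monic D → (∀ a → ¬ lin a * lin a ∣ D) → D ∣ roots as ^ m → D ∣ roots as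
    squarefree∣roots-on []       m D _ _ D∣ = ∣-respʳ (1^≈1 m) D∣
    squarefree∣roots-on (a ∷ as) m D D-monic simple (E , ED≈) =
      case (split a m E D (roots as ^ m) (A.trans ED≈ (^-distrib-* (lin a) (roots as) m)))
      where
      case : Split a m E D (roots as ^ m) → D ∣ lin a * roots as
      case record { e = e ; D₀ = D₀ ; E₀ = E₀ ; D≈ = D≈ ; E₀D₀≈S = q } =
        ∣-respˡ (A.sym D≈) (*-mono-∣ {lin a ^ e} {lin a} {D₀} {roots as} (lin^∣lin e ≡.refl)
          (squarefree∣roots-on as m D₀ (Monic-quotient D₀ (lin a ^ e) {D} (A.trans (A.*-comm D₀ (lin a ^ e)) (A.sym D≈))
              (Monic-^ {lin a} e (Monic-lin a)) D-monic)
            (λ b l²∣D₀ → simple b (∣-respʳ (A.sym D≈) (∣-*ˡ {lin b * lin b} (lin a ^ e) l²∣D₀)))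
            (E₀ , q)))
        where
        lin^∣lin : ∀ n → e ≡ n → lin a ^ n ∣ lin a
        lin^∣lin zero          _ = 1∣ (lin a)
        lin^∣lin (suc zero)    _ = ∣-respˡ (A.sym (A.*-identityʳ (lin a))) ∣-refl
        lin^∣lin (suc (suc n)) ≡.refl = contradiction
          (∣-respʳ (A.sym D≈) (lin a ^ n * D₀ , solve 3 (λ l m d → (m :* d) :* (l :* l) := (l :* (l :* m)) :* d) A.refl (lin a) (lin a ^ n) D₀))
          (simple a)

  squarefree∣roots : ∀ m D → Monic D → (∀ a → ¬ lin a * lin a ∣ D) → D ∣ roots els ^ m → D ∣ roots els
  squarefree∣roots = squarefree∣roots-on els

-- Perfection as a splitting condition

module Perfect {c ℓ : Level} (R : CommutativeRing c ℓ) (isField : IsDecidableField R)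
  (els : List (CommutativeRing.Carrier R))
  (els! : UniqueSetoid.Unique (CommutativeRing.setoid R) els)
  (complete : ∀ a → Membership._∈_ (CommutativeRing.setoid R) a els)
  (1<q : 1 < length els) where

  private
    module R = CommutativeRing R
    module RP = RingProperties R.ring

  open IsDecidableField isField
  open Polynomial R
  open RawMagmaDefs (RawRing.*-rawMagma polyRawRing) using (_,_)
  open PolynomialRing R
  open LeadingTerm R
  open LinearFactors R isField
  open BiUnitary R isField
  open FiniteField R isField els els! complete 1<q
  open SemiringSolver A.commutativeSemiring using (solve; _:+_; _:*_; _:=_)
  open Membership R.setoid using (_∈_)
  open SetoidReasoning A.setoid

  -- Two blocks of r consecutive exponents with r missing between them; the second is the first
  -- shifted by r + 1, which is the source of the factor x^(r+1) + 1.
  exps : ℕ → List ℕ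
  exps r = downFrom r ++ map (suc r ℕ.+_) (downFrom r)

  exps! : ∀ r → Uniqueₙ (exps r)
  exps! r = UniquePₙ.++⁺ (UniquePₙ.downFrom⁺ r) (UniquePₙ.map⁺ (λ {i} {j} → ℕ.+-cancelˡ-≡ (suc r) i j) (UniquePₙ.downFrom⁺ r)) disjoint
    where
    disjoint : ∀ {e} → ¬ (e ∈ₙ downFrom r × e ∈ₙ map (suc r ℕ.+_) (downFrom r))
    disjoint (e∈ , e∈′) with MembershipPₙ.∈-map⁻ (suc r ℕ.+_) e∈′
    ... | i , _ , ≡.refl = ℕ.m+n≮m r i (ℕ.<-trans (ℕ.n<1+n _) (MembershipPₙ.∈-downFrom⁻ e∈))

  ∈-exps : ∀ r {e} → e ∈ₙ exps r ⇔ (e ℕ.≤ 2 ℕ.* r × ¬ e ≡ r)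
  ∈-exps r = mk⇔ to from
    where
    to : ∀ {e} → e ∈ₙ exps r → e ℕ.≤ 2 ℕ.* r × ¬ e ≡ r
    to e∈ with MembershipPₙ.∈-++⁻ (downFrom r) e∈
    ... | inj₁ e∈ˡ = let e<r = MembershipPₙ.∈-downFrom⁻ e∈ˡ in
      ℕ.≤-trans (ℕ.<⇒≤ e<r) (ℕ.m≤m+n r (r ℕ.+ 0)) , ℕ.<⇒≢ e<r
    ... | inj₂ e∈ʳ with MembershipPₙ.∈-map⁻ (suc r ℕ.+_) e∈ʳ
    ...   | i , i∈ , ≡.refl =
      ℕ.≤-trans (ℕ.≤-reflexive (≡.sym (ℕ.+-suc r i))) (ℕ.+-monoʳ-≤ r (ℕ.≤-trans (MembershipPₙ.∈-downFrom⁻ i∈) (ℕ.m≤m+n r 0))) ,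
      λ e≡r → ℕ.<⇒≢ (s≤s (ℕ.m≤m+n r i)) (≡.sym e≡r)
    from : ∀ {e} → e ℕ.≤ 2 ℕ.* r × ¬ e ≡ r → e ∈ₙ exps r
    from {e} (e≤2r , e≢r) with ℕ.<-cmp e r
    ... | tri< e<r _ _ = MembershipPₙ.∈-++⁺ˡ (MembershipPₙ.∈-downFrom⁺ e<r)
    ... | tri≈ _ e≡r _ = contradiction e≡r e≢r
    ... | tri> _ _ r<e = MembershipPₙ.∈-++⁺ʳ (downFrom r) (≡.subst (_∈ₙ map (suc r ℕ.+_) (downFrom r)) (ℕ.m+[n∸m]≡n r<e)
      (MembershipPₙ.∈-map⁺ (suc r ℕ.+_) (MembershipPₙ.∈-downFrom⁺
        (ℕ.+-cancelˡ-< (suc r) (e ℕ.∸ suc r) r (≡.subst (ℕ._< suc r ℕ.+ r) (≡.sym (ℕ.m+[n∸m]≡n r<e))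
          (s≤s (ℕ.≤-trans e≤2r (ℕ.≤-reflexive (≡.cong (r ℕ.+_) (ℕ.+-identityʳ r))))))))))

  powerSum-cong : ∀ es {P Q} → P ≈ Q → powerSum es P ≈ powerSum es Q
  powerSum-cong []       e = A.refl
  powerSum-cong (n ∷ es) e = A.+-cong (^-congˡ n e) (powerSum-cong es e)

  -- This is f, the sum of the admissible powers of x; its translates f(x - a) are the local factors
  -- of σ** of A.
  σX : ℕ → Poly
  σX r = powerSum (exps r) X

  σ-product : ℕ → List R.Carrier → Poly
  σ-product r = foldr (λ a S → powerSum (exps r) (lin a) * S) 1ₚ

  lin0≈X : lin R.0# ≈ X
  lin0≈X = A.trans (lin≈ R.0#) (A.trans (+-congˡ X (A.trans (A.-‿cong C-0) AP.-0#≈0#)) (A.+-identityʳ X))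

  -- The factor of the product that belongs to a = 0 is f itself.
  σX∣σ-product : ∀ r as → R.0# ∈ as → σX r ∣ σ-product r as
  σX∣σ-product r (a ∷ as) (here 0≈a) = ∣-*ʳ {σX r} (σ-product r as) (∣-respʳ
    (powerSum-cong (exps r) (A.trans (A.sym lin0≈X) (lin-cong 0≈a))) ∣-refl)
  σX∣σ-product r (a ∷ as) (there 0∈) = ∣-*ˡ {σX r} (powerSum (exps r) (lin a)) (σX∣σ-product r as 0∈)

  -- Composition of polynomials is evaluation in the polynomial ring.
  module _ (Q : Poly) where
    open Evaluation R polyRing C C-cong (λ _ _ → A.refl) C-* C-0 A.refl Q public
      renaming (eval to compose; eval-cong to compose-cong; eval-+ to compose-+; eval-* to compose-*; eval-1 to compose-1;
                eval-X to compose-X; eval-C to compose-C; eval-neg to compose-neg; eval-- to compose--; eval-^ to compose-^)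

  compose-powerSum : ∀ Q es → compose Q (powerSum es X) ≈ powerSum es Q
  compose-powerSum Q []       = A.refl
  compose-powerSum Q (e ∷ es) = A.trans (compose-+ Q (X ^ e) (powerSum es X))
    (A.+-cong (A.trans (compose-^ Q X e) (^-congˡ e (compose-X Q))) (compose-powerSum Q es))

  compose-lin : ∀ a b → compose (lin a) (lin b) ≈ lin (a R.+ b)
  compose-lin a b = begin
    compose (lin a) (lin b)          ≈⟨ compose-cong (lin a) (lin≈ b) ⟩
    compose (lin a) (X - C b)        ≈⟨ compose-- (lin a) X (C b) ⟩
    compose (lin a) X - compose (lin a) (C b) ≈⟨ A.+-cong (compose-X (lin a)) (A.-‿cong (compose-C (lin a) b)) ⟩
    lin a - C b                      ≈⟨ +-congʳ (A.- C b) (lin≈ a) ⟩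
    (X - C a) - C b                  ≈⟨ A.+-assoc X (A.- C a) (A.- C b) ⟩
    X + (A.- C a + A.- C b)          ≈⟨ +-congˡ X (AP.-‿+-comm (C a) (C b)) ⟩
    X - (C a + C b)                  ≈⟨ lin≈ (a R.+ b) ⟨
    lin (a R.+ b)                    ∎

  compose-roots : ∀ a L → compose (lin a) (roots L) ≈ roots (map (a R.+_) L)
  compose-roots a []      = compose-1 (lin a)
  compose-roots a (b ∷ L) = A.trans (compose-* (lin a) (lin b) (roots L)) (A.*-cong (compose-lin a b) (compose-roots a L))

  private
    product : (R.Carrier → Poly) → List R.Carrier → Poly
    product f = foldr (λ a S → f a * S) 1ₚ

    product-cong : ∀ {f g} → (∀ a → f a ≈ g a) → ∀ as → product f as ≈ product g as
    product-cong h []       = A.refl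
    product-cong h (a ∷ as) = A.*-cong (h a) (product-cong h as)

    product-* : ∀ f g as → product (λ a → f a * g a) as ≈ product f as * product g as
    product-* f g []       = A.sym (A.*-identityˡ 1ₚ)
    product-* f g (a ∷ as) = A.trans (*-congˡ (f a * g a) (product-* f g as))
      (solve 4 (λ x y u v → (x :* y) :* (u :* v) := (x :* u) :* (y :* v)) A.refl (f a) (g a) (product f as) (product g as))

    product-lin : ∀ b as → product (λ a → lin (a R.+ b)) as ≈ roots (map (R._+ b) as)
    product-lin b []       = A.refl
    product-lin b (a ∷ as) = *-congˡ (lin (a R.+ b)) (product-lin b as)

    product-1 : ∀ as → product (λ _ → 1ₚ) as ≈ 1ₚ
    product-1 []       = A.refl
    product-1 (a ∷ as) = A.trans (A.*-identityˡ _) (product-1 as)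

    -- The two products are exchanged: each b in L contributes one full product over the field,
    -- hence the exponent `length L`.
    product-translates : ∀ L → product (λ a → roots (map (a R.+_) L)) els ≈ roots els ^ length L
    product-translates []      = product-1 els
    product-translates (b ∷ L) = A.trans (product-* (λ a → lin (a R.+ b)) (λ a → roots (map (a R.+_) L)) els)
      (A.*-cong (A.trans (product-lin b els) (roots-translate b)) (product-translates L))

  splits⇒σ-product : ∀ r L → σX r ≈ roots L → σ-product r els ≈ roots els ^ length L
  splits⇒σ-product r L σX≈ = A.trans (product-cong (λ a → begin
    powerSum (exps r) (lin a)       ≈⟨ compose-powerSum (lin a) (exps r) ⟨
    compose (lin a) (σX r)          ≈⟨ compose-cong (lin a) σX≈ ⟩
    compose (lin a) (roots L)       ≈⟨ compose-roots a L ⟩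
    roots (map (a R.+_) L)          ∎) els) (product-translates L)

  -- The values u = 1 and u = -1 treat x^r - 1 and x^(r+1) + 1 alike.
  binom : ℕ → R.Carrier → Poly
  binom n u = X ^ n - C u

  Lead-binom : ∀ {n} u → 0 < n → Lead (binom n u) n R.1#
  Lead-binom {n} u 0<n = Lead-+ˡ {X ^ n} {A.- C u} (Lead-X^ n)
    λ { (suc m) _ → R.refl ; zero n≤0 → contradiction (ℕ.<-≤-trans 0<n n≤0) λ () }

  private
    shift-- : ∀ P Q S T → P + Q ≈ S + T → P - T ≈ S - Q
    shift-- P Q S T e = begin
      P - T                             ≈⟨ A.+-identityʳ (P - T) ⟨
      (P - T) + 0ₚ                      ≈⟨ +-congˡ (P - T) (A.-‿inverseʳ Q) ⟨
      (P - T) + (Q - Q)                 ≈⟨ solve 4 (λ p q t′ q′ → (p :+ t′) :+ (q :+ q′) := (p :+ q) :+ (t′ :+ q′)) A.refl P Q (A.- T) (A.- Q) ⟩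
      (P + Q) + (A.- T + A.- Q)         ≈⟨ +-congʳ (A.- T + A.- Q) e ⟩
      (S + T) + (A.- T + A.- Q)         ≈⟨ solve 4 (λ s t t′ q′ → (s :+ t) :+ (t′ :+ q′) := (s :+ q′) :+ (t :+ t′)) A.refl S T (A.- T) (A.- Q) ⟩
      (S - Q) + (T - T)                 ≈⟨ +-congˡ (S - Q) (A.-‿inverseʳ T) ⟩
      (S - Q) + 0ₚ                      ≈⟨ A.+-identityʳ (S - Q) ⟩
      S - Q                             ∎

    -- P g = Pⁿ - 1 + g, with both sides moved so that no subtraction occurs.
    geometric : ∀ P n → P * powerSum (downFrom n) P + 1ₚ ≈ P ^ n + powerSum (downFrom n) P
    geometric P zero    = A.trans (+-congʳ 1ₚ (A.zeroʳ P)) (A.trans (A.+-identityˡ 1ₚ) (A.sym (A.+-identityʳ 1ₚ)))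
    geometric P (suc n) = begin
      P * (P ^ n + g) + 1ₚ              ≈⟨ +-congʳ 1ₚ (A.distribˡ P (P ^ n) g) ⟩
      (P * P ^ n + P * g) + 1ₚ          ≈⟨ A.+-assoc (P * P ^ n) (P * g) 1ₚ ⟩
      P * P ^ n + (P * g + 1ₚ)          ≈⟨ +-congˡ (P * P ^ n) (geometric P n) ⟩
      P * P ^ n + (P ^ n + g)           ∎
      where
      g : Poly
      g = powerSum (downFrom n) P

    powerSum-++ : ∀ P es fs → powerSum (es ++ fs) P ≈ powerSum es P + powerSum fs P
    powerSum-++ P []       fs = A.refl
    powerSum-++ P (e ∷ es) fs = A.trans (+-congˡ (P ^ e) (powerSum-++ P es fs)) (A.sym (A.+-assoc (P ^ e) (powerSum es P) (powerSum fs P)))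

    powerSum-shift : ∀ P k es → powerSum (map (k ℕ.+_) es) P ≈ P ^ k * powerSum es P
    powerSum-shift P k []       = A.sym (A.zeroʳ (P ^ k))
    powerSum-shift P k (e ∷ es) = A.trans (A.+-cong (^-homo-* P k e) (powerSum-shift P k es)) (A.sym (A.distribˡ (P ^ k) (P ^ e) (powerSum es P)))

  -- With g = 1 + x + ... + x^(r-1) the two blocks of exponents give f = g + x^(r+1) g, and (x - 1)
  -- g = x^r - 1. The factor x - 1 stays on the left so that no quotient has to be formed.
  σX-factors : ∀ r → σX r * lin R.1# ≈ binom r R.1# * binom (suc r) (R.- R.1#)
  σX-factors r = begin
    σX r * lin R.1#                              ≈⟨ *-congʳ (lin R.1#) (A.trans (powerSum-++ X (downFrom r) (map (suc r ℕ.+_) (downFrom r))) (+-congˡ g (powerSum-shift X (suc r) (downFrom r)))) ⟩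
    (g + X^r+1 * g) * lin R.1#                   ≈⟨ *-congˡ (g + X^r+1 * g) (lin≈ R.1#) ⟩
    (g + X^r+1 * g) * (X - 1ₚ)                   ≈⟨ *-congʳ (X - 1ₚ) (+-congʳ (X^r+1 * g) (A.sym (A.*-identityˡ g))) ⟩
    (1ₚ * g + X^r+1 * g) * (X - 1ₚ)              ≈⟨ solve 4 (λ o g x l → (o :* g :+ x :* g) :* l := (l :* g) :* (x :+ o)) A.refl 1ₚ g X^r+1 (X - 1ₚ) ⟩
    ((X - 1ₚ) * g) * (X^r+1 + 1ₚ)                ≈⟨ A.*-cong [X-1]g≈ (+-congˡ X^r+1 1≈) ⟩
    binom r R.1# * binom (suc r) (R.- R.1#)      ∎
    where
    g X^r+1 : Poly
    g = powerSum (downFrom r) X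
    X^r+1 = X ^ suc r
    1≈ : 1ₚ ≈ A.- C (R.- R.1#)
    1≈ = C-cong (R.sym (RP.-‿involutive R.1#))
    [X-1]g≈ : (X - 1ₚ) * g ≈ binom r R.1#
    [X-1]g≈ = A.trans (AP.[y-z]x≈yx-zx g X 1ₚ) (A.trans (+-congˡ (X * g) (A.-‿cong (A.*-identityˡ g)))
      (shift-- (X * g) 1ₚ (X ^ r) g (geometric X r)))

  -- Read off the factorisation instead of the sum: the degree is r + (r + 1) - 1.
  Lead-σX : ∀ r → 0 < r → Lead (σX r) (2 ℕ.* r) R.1#
  Lead-σX r 0<r =
    let (e , e-lead , e+1≡) = Lead-quotient (σX r) (lin R.1#) (σX-factors r) (Lead-lin R.1#) Lead-factors
    in ≡.subst (λ k → Lead (σX r) k R.1#) (ℕ.suc-injective (≡.trans (ℕ.+-comm 1 e)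
         (≡.trans e+1≡ (≡.trans (ℕ.+-suc r r) (≡.cong (λ k → suc (r ℕ.+ k)) (≡.sym (ℕ.+-identityʳ r))))))) e-lead
    where
    Lead-factors : Lead (binom r R.1# * binom (suc r) (R.- R.1#)) (r ℕ.+ suc r) R.1#
    Lead-factors = Lead-resp-≈ (R.*-identityˡ R.1#) (Lead-* (Lead-binom {r} R.1# 0<r) (Lead-binom {suc r} (R.- R.1#) z<s))

  -- A perfect A equals the product of the f(x - a), so f divides a power of the product of all x -
  -- a. Conversely the root list of f has length deg f = 2r, which is exactly the exponent required
  -- in A.
  perfect⇔σX∣roots^ : ∀ r → 0 < r → BiUnitaryPerfect ((X ^ q - X) ^ (2 ℕ.* r)) ⇔ (∃ λ m → σX r ∣ roots els ^ m)
  perfect⇔σX∣roots^ r 0<r = mk⇔ to from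
    where
    S≈ : (X ^ q - X) ^ (2 ℕ.* r) ≈ roots els ^ (2 ℕ.* r)
    S≈ = ^-congˡ (2 ℕ.* r) X^q-X≈roots

    Ds : List Poly
    Ds = biunitaryDivisors r 0<r (exps r) (exps! r) (∈-exps r) els

    sum≈ : foldr _+_ 0ₚ Ds ≈ σ-product r els
    sum≈ = sum-biunitaryDivisors r 0<r (exps r) (exps! r) (∈-exps r) els

    perfect⇔ : BiUnitaryPerfect ((X ^ q - X) ^ (2 ℕ.* r)) ⇔ (foldr _+_ 0ₚ Ds ≈ (X ^ q - X) ^ (2 ℕ.* r))
    perfect⇔ = σ**-unique (biunitaryDivisors! r 0<r (exps r) (exps! r) (∈-exps r) els els!)
      (λ {D} D∈ → IsBiUnitaryDivisor-respʳ {D} (A.sym S≈) (∈⇒biunitary r 0<r (exps r) (exps! r) (∈-exps r) els els! D∈))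
      (λ {D} b → biunitary⇒∈ r 0<r (exps r) (exps! r) (∈-exps r) els els! (IsBiUnitaryDivisor-respʳ {D} S≈ b))

    to : BiUnitaryPerfect ((X ^ q - X) ^ (2 ℕ.* r)) → ∃ λ m → σX r ∣ roots els ^ m
    to perfect = 2 ℕ.* r , ∣-respʳ (A.trans (A.sym sum≈) (A.trans (Equivalence.to perfect⇔ perfect) S≈))
      (σX∣σ-product r els (complete R.0#))

    from : (∃ λ m → σX r ∣ roots els ^ m) → BiUnitaryPerfect ((X ^ q - X) ^ (2 ℕ.* r))
    from (m , σX∣) = let (L , σX≈) = ∣roots^⇒roots m (σX r) (monic (Lead-σX r 0<r)) σX∣
                         (|L|≡ , _) = Lead-unique 1≉0 1≉0 (Lead-resp (A.sym σX≈) (Lead-roots L)) (Lead-σX r 0<r)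
      in Equivalence.from perfect⇔ (A.trans sum≈ (A.trans (splits⇒σ-product r L σX≈)
           (A.trans (^-congʳ (roots els) |L|≡) (A.sym S≈))))

  -- The exponent is left free so that multiplicities of roots need no bookkeeping.
  record Splits (n : ℕ) (u : R.Carrier) : Set (c ⊔ ℓ) where
    constructor _,_
    field
      exponent : ℕ
      divides  : binom n u ∣ roots els ^ exponent

  -- The factor x - 1 by which f differs from the product of the binomials divides the product over
  -- the field; it costs one extra power in one direction and is simply dropped in the other.
  σX∣roots^⇔ : ∀ r → (∃ λ m → σX r ∣ roots els ^ m) ⇔
    (Splits r R.1# × Splits (suc r) (R.- R.1#))
  σX∣roots^⇔ r = mk⇔ to from
    where
    to : (∃ λ m → σX r ∣ roots els ^ m) →
         Splits r R.1# × Splits (suc r) (R.- R.1#)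
    to (m , σX∣) = (suc m , ∣-trans (binom (suc r) (R.- R.1#) , A.*-comm (binom (suc r) (R.- R.1#)) (binom r R.1#)) both)
                 , (suc m , ∣-trans (binom r R.1# , A.refl) both)
      where
      lin1∣roots : lin R.1# ∣ roots els
      lin1∣roots = lin∣roots els (complete R.1#)
        where
        lin∣roots : ∀ as → R.1# ∈ as → lin R.1# ∣ roots as
        lin∣roots (a ∷ as) (here 1≈a)  = ∣-*ʳ {lin R.1#} (roots as) (∣-respʳ (lin-cong 1≈a) ∣-refl)
        lin∣roots (a ∷ as) (there 1∈) = ∣-*ˡ {lin R.1#} (lin a) (lin∣roots as 1∈)
      both : binom r R.1# * binom (suc r) (R.- R.1#) ∣ roots els ^ suc m
      both = ∣-respˡ (σX-factors r) (∣-respʳ (A.*-comm (roots els ^ m) (roots els)) (*-mono-∣ {σX r} {roots els ^ m} {lin R.1#} {roots els} σX∣ lin1∣roots))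
    from : Splits r R.1# × Splits (suc r) (R.- R.1#) →
           (∃ λ m → σX r ∣ roots els ^ m)
    from ((m , h) , (n , k)) = m ℕ.+ n , ∣-trans (lin R.1# , A.trans (A.*-comm (lin R.1#) (σX r)) (σX-factors r))
      (∣-respʳ (A.sym (^-homo-* (roots els) m n)) (*-mono-∣ {binom r R.1#} {roots els ^ m} {binom (suc r) (R.- R.1#)} {roots els ^ n} h k))

-- Splitting of binomials

prime>1 : ∀ {p} → Prime p → 1 < p
prime>1 p-prime = ℕ.nonTrivial⇒n>1 _ {{prime⇒nonTrivial p-prime}}

prime∤! : ∀ {p} → Prime p → ∀ k → k < p → ¬ p ℕ.∣ k ℕ.!
prime∤! p-prime zero    _   p∣1 = ℕ.<⇒≱ (prime>1 p-prime) (ℕ.∣⇒≤ p∣1)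
prime∤! p-prime (suc k) k<p p∣ with euclidsLemma (suc k) (k ℕ.!) p-prime p∣
... | inj₁ p∣k  = ℕ.<⇒≱ k<p (ℕ.∣⇒≤ p∣k)
... | inj₂ p∣k! = prime∤! p-prime k (ℕ.<-trans (ℕ.n<1+n k) k<p) p∣k!

-- The prime p divides p! = C(p,k) k! (p-k)!, but neither of the two factorials on the right, as k
-- and p - k are below p.
prime∣C : ∀ {p k} → Prime p → 0 < k → k < p → p ℕ.∣ p ℕ.C k
prime∣C {p} {k} p-prime 0<k k<p
  with euclidsLemma (p ℕ.C k) (k ℕ.! ℕ.* (p ℕ.∸ k) ℕ.!) p-prime (≡.subst (p ℕ.∣_) (≡.sym pCk*≡) (p∣p! p (prime>1 p-prime)))
  where
  k≤p : k ℕ.≤ p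
  k≤p = ℕ.<⇒≤ k<p
  pCk*≡ : (p ℕ.C k) ℕ.* (k ℕ.! ℕ.* (p ℕ.∸ k) ℕ.!) ≡ p ℕ.!
  pCk*≡ = ≡.trans (≡.cong (ℕ._* (k ℕ.! ℕ.* (p ℕ.∸ k) ℕ.!)) (ℕ.nCk≡n!/k![n-k]! k≤p))
    (ℕ.m/n*n≡m {{k ℕ.!* (p ℕ.∸ k) !≢0}} (ℕ.k![n∸k]!∣n! k≤p))
  p∣p! : ∀ n → 1 < n → n ℕ.∣ n ℕ.!
  p∣p! (suc n) _ = ℕ.m∣m*n (n ℕ.!)
... | inj₁ p∣C = p∣C
... | inj₂ p∣k![p-k]! with euclidsLemma (k ℕ.!) ((p ℕ.∸ k) ℕ.!) p-prime p∣k![p-k]!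
...   | inj₁ p∣k!   = contradiction p∣k! (prime∤! p-prime k k<p)
...   | inj₂ p∣p-k! = contradiction p∣p-k! (prime∤! p-prime (p ℕ.∸ k) (ℕ.∸-monoʳ-< 0<k (ℕ.<⇒≤ k<p)))

prime∤⇒coprime : ∀ {p n} → Prime p → ¬ p ℕ.∣ n → Coprime n p
prime∤⇒coprime p-prime p∤n (i∣n , i∣p) with prime⇒irreducible p-prime i∣p
... | inj₁ i≡1    = i≡1
... | inj₂ ≡.refl = contradiction i∣n p∤n

-- The Frobenius identity

module Frobenius {c ℓ : Level} (S : CommutativeSemiring c ℓ) where

  open CommutativeSemiring S hiding (zero)
  open Exp semiring
  open Mult semiring renaming (_×_ to _×′_)
  open Sum semiring using (sum; sum-init-last; sum-cong-≋; sum-replicate-zero)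
  open Binomial S using (binomialTerm; theorem)
  open SetoidReasoning setoid

  -- In the binomial expansion every coefficient but the outer two is a multiple of p and kills its
  -- term.
  frobenius : ∀ {p} → Prime p → (∀ x → p ×′ x ≈ 0#) → ∀ x y → (x + y) ^ p ≈ x ^ p + y ^ p
  frobenius {zero}  p-prime _    = contradiction (prime>1 p-prime) λ ()
  frobenius {suc n} p-prime char x y = begin
    (x + y) ^ suc n                                       ≈⟨ theorem (suc n) x y ⟩
    t Fin.zero + sum (λ i → t (Fin.suc i))                ≈⟨ +-congˡ (sum-init-last (λ i → t (Fin.suc i))) ⟩
    t Fin.zero + (sum (λ i → t (Fin.suc (inject₁ i))) + t (Fin.suc (fromℕ n)))
                                                          ≈⟨ +-cong first (+-cong (trans (sum-cong-≋ middle) (sum-replicate-zero n)) last) ⟩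
    y ^ suc n + (0# + x ^ suc n)                          ≈⟨ +-congˡ (+-identityˡ _) ⟩
    y ^ suc n + x ^ suc n                                 ≈⟨ +-comm _ _ ⟩
    x ^ suc n + y ^ suc n                                 ∎
    where
    t : Fin (suc (suc n)) → Carrier
    t = binomialTerm x y (suc n)

    first : t Fin.zero ≈ y ^ suc n
    first = trans (×-homo-1 _) (*-identityˡ _)

    last : t (Fin.suc (fromℕ n)) ≈ x ^ suc n
    last = begin
      t (Fin.suc (fromℕ n))                               ≡⟨ ≡.cong (λ k → (suc n ℕ.C suc k) ×′ (x ^ suc k * y ^ (n ℕ.∸ k))) (Fin.toℕ-fromℕ n) ⟩
      (suc n ℕ.C suc n) ×′ (x ^ suc n * y ^ (n ℕ.∸ n))      ≡⟨ ≡.cong₂ (λ c e → c ×′ (x ^ suc n * y ^ e)) (ℕ.nCn≡1 (suc n)) (ℕ.n∸n≡0 n) ⟩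
      1 ×′ (x ^ suc n * 1#)                               ≈⟨ ×-homo-1 _ ⟩
      x ^ suc n * 1#                                      ≈⟨ *-identityʳ _ ⟩
      x ^ suc n                                           ∎

    ∣⇒×≈0 : ∀ {m} z → suc n ℕ.∣ m → m ×′ z ≈ 0#
    ∣⇒×≈0 z (ℕ.divides k ≡.refl) = begin
      (k ℕ.* suc n) ×′ z      ≡⟨ ≡.cong (_×′ z) (ℕ.*-comm k (suc n)) ⟩
      (suc n ℕ.* k) ×′ z      ≈⟨ ×-assocˡ z (suc n) k ⟨
      suc n ×′ (k ×′ z)       ≈⟨ char (k ×′ z) ⟩
      0#                      ∎

    middle : ∀ i → t (Fin.suc (inject₁ i)) ≈ 0#
    middle i = ∣⇒×≈0 _ (prime∣C p-prime z<s (s<s (≡.subst (ℕ._< n) (≡.sym (Fin.toℕ-inject₁ i)) (Fin.toℕ<n i))))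

-- Binomials over a field with p² elements

module Splitting {c ℓ : Level} (R : CommutativeRing c ℓ) (isField : IsDecidableField R)
  (els : List (CommutativeRing.Carrier R))
  (els! : UniqueSetoid.Unique (CommutativeRing.setoid R) els)
  (complete : ∀ a → Membership._∈_ (CommutativeRing.setoid R) a els)
  (1<q : 1 < length els)
  (p : ℕ) (p-prime : Prime p) (p∤2 : ¬ p ℕ.∣ 2) (q≡p² : length els ≡ p ℕ.^ 2) where

  private
    module R = CommutativeRing R
    module RP = RingProperties R.ring

  open IsDecidableField isField
  open Polynomial R
  open RawMagmaDefs (RawRing.*-rawMagma polyRawRing) using (_,_)
  open PolynomialRing R
  open LeadingTerm R
  open LinearFactors R isField
  open BiUnitary R isField
  open FiniteField R isField els els! complete 1<q
  open Perfect R isField els els! complete 1<q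
  open Exp R.semiring using () renaming (_^_ to _^ᵣ_)
  module ^ᵣ = Exp R.semiring
  module ×ᵣ = Mult R.semiring
  open Mult R.semiring using () renaming (_×_ to _×ᵣ_)
  open Mult A.semiring using () renaming (_×_ to _×ₚ_)
  open SemiringSolver A.commutativeSemiring using (solve; _:+_; _:*_; _:=_)
  open SetoidReasoning A.setoid

  -- As q = p², the vanishing of q·1 is that of (p·1)(p·1), and a field has no zero divisors.
  p×1≈0 : p ×ᵣ R.1# R.≈ R.0#
  p×1≈0 with integral (R.trans (R.sym (×ᵣ.×1-homo-* p (p ℕ.* 1))) (R.trans (×ᵣ.×-congˡ {R.1#} (≡.sym q≡p²)) q×1≈0))
  ... | inj₁ e = e
  ... | inj₂ e = R.trans (×ᵣ.×-congˡ {R.1#} (≡.sym (ℕ.*-identityʳ p))) e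

  private
    multiple×1≈0 : ∀ k n → n ×ᵣ R.1# R.≈ R.0# → (k ℕ.* n) ×ᵣ R.1# R.≈ R.0#
    multiple×1≈0 k n e = R.trans (×ᵣ.×1-homo-* k n) (R.trans (R.*-congˡ e) (R.zeroʳ _))

    1+≢ : ∀ {m n} → m ×ᵣ R.1# R.≈ R.0# → n ×ᵣ R.1# R.≈ R.0# → ¬ 1 ℕ.+ m ≡ n
    1+≢ m≈0 n≈0 ≡.refl = 1≉0 (R.trans (R.sym (R.+-identityʳ R.1#)) (R.trans (R.+-congˡ (R.sym m≈0)) n≈0))

  -- By Bézout some multiples of n and p differ by 1; if both n·1 and p·1 vanished, so would 1.
  p∤n⇒n×1≉0 : ∀ {n} → ¬ p ℕ.∣ n → ¬ n ×ᵣ R.1# R.≈ R.0#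
  p∤n⇒n×1≉0 {n} p∤n n×1≈0 with coprime-Bézout (prime∤⇒coprime p-prime p∤n)
  ... | Bézout.+- x y eq = 1+≢ (multiple×1≈0 y p p×1≈0) (multiple×1≈0 x n n×1≈0) eq
  ... | Bézout.-+ x y eq = 1+≢ (multiple×1≈0 x n n×1≈0) (multiple×1≈0 y p p×1≈0) eq

  -1≉1 : ¬ R.- R.1# R.≈ R.1#
  -1≉1 e = p∤n⇒n×1≉0 p∤2 (R.trans (R.+-congˡ (R.+-identityʳ R.1#))
    (R.trans (R.+-congʳ (R.sym e)) (R.-‿inverseˡ R.1#)))

  private
    telescope : ∀ P Q S → P - S ≈ (P - Q) + (Q - S)
    telescope P Q S = A.sym (begin
      (P - Q) + (Q - S)              ≈⟨ solve 4 (λ p q q′ s → (p :+ q′) :+ (q :+ s) := (p :+ s) :+ (q :+ q′)) A.refl P Q (A.- Q) (A.- S) ⟩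
      (P - S) + (Q - Q)              ≈⟨ +-congˡ (P - S) (A.-‿inverseʳ Q) ⟩
      (P - S) + 0ₚ                   ≈⟨ A.+-identityʳ (P - S) ⟩
      P - S                          ∎)

    ∣-- : ∀ D {P Q} → D ∣ P → D ∣ Q → D ∣ P - Q
    ∣-- D {P} {Q} (E , e) (G , g) = E - G , A.trans (AP.[y-z]x≈yx-zx D E G) (A.+-cong e (A.-‿cong g))

  -- (Pⁿ - Qⁿ) / (P - Q).  For P = X and Q = a its value at a is n aⁿ⁻¹, which
  -- replaces the derivative of Xⁿ in the proof that the roots are simple.
  powerQuotient : Poly → Poly → ℕ → Poly
  powerQuotient P Q zero    = 0ₚ
  powerQuotient P Q (suc n) = P * powerQuotient P Q n + Q ^ n

  powerQuotient-* : ∀ P Q n → powerQuotient P Q n * (P - Q) ≈ P ^ n - Q ^ n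
  powerQuotient-* P Q zero    = A.sym (A.-‿inverseʳ 1ₚ)
  powerQuotient-* P Q (suc n) = begin
    (P * G + Q ^ n) * (P - Q)                     ≈⟨ solve 4 (λ p g r d → (p :* g :+ r) :* d := p :* (g :* d) :+ d :* r) A.refl P G (Q ^ n) (P - Q) ⟩
    P * (G * (P - Q)) + (P - Q) * Q ^ n           ≈⟨ +-congʳ ((P - Q) * Q ^ n) (*-congˡ P (powerQuotient-* P Q n)) ⟩
    P * (P ^ n - Q ^ n) + (P - Q) * Q ^ n         ≈⟨ A.+-cong (AP.x[y-z]≈xy-xz P (P ^ n) (Q ^ n)) (AP.[y-z]x≈yx-zx (Q ^ n) P Q) ⟩
    (P * P ^ n - P * Q ^ n) + (P * Q ^ n - Q * Q ^ n) ≈⟨ telescope (P * P ^ n) (P * Q ^ n) (Q * Q ^ n) ⟨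
    P * P ^ n - Q * Q ^ n                         ∎
    where
    G : Poly
    G = powerQuotient P Q n

  C-^ : ∀ u n → C u ^ n ≈ C (u ^ᵣ n)
  C-^ u zero    = A.refl
  C-^ u (suc n) = A.trans (*-congˡ (C u) (C-^ u n)) (A.sym (C-* u (u ^ᵣ n)))

  binom-cong : ∀ n {u v} → u R.≈ v → binom n u ≈ binom n v
  binom-cong n e = +-congˡ (X ^ n) (A.-‿cong (C-cong e))

  -- The identity behind it is that y - u divides y^t - u^t, taken at y = x^n.
  binom∣binom : ∀ n t u → binom n u ∣ binom (n ℕ.* t) (u ^ᵣ t)
  binom∣binom n t u = powerQuotient (X ^ n) (C u) t , A.trans (powerQuotient-* (X ^ n) (C u) t)
    (A.+-cong (^-assocʳ X n t) (A.-‿cong (C-^ u t)))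

  -- The extra factor a turns n aⁿ⁻¹ into n aⁿ, so that no exponent n - 1 occurs.
  eval-powerQuotient : ∀ a n → eval a (powerQuotient X (C a) n) R.* a R.≈ n ×ᵣ (a ^ᵣ n)
  eval-powerQuotient a zero    = R.zeroˡ a
  eval-powerQuotient a (suc n) = ≈ᵣ.begin
    eval a (X * G + C a ^ n) R.* a                      ≈ᵣ.≈⟨ R.*-congʳ (R.trans (eval-+ a (X * G) (C a ^ n)) (R.+-cong (R.trans (eval-* a X G) (R.*-congʳ (eval-X a))) (R.trans (eval-cong a (C-^ a n)) (eval-C a (a ^ᵣ n))))) ⟩
    (a R.* eval a G R.+ a ^ᵣ n) R.* a                   ≈ᵣ.≈⟨ R.distribʳ a _ _ ⟩
    a R.* eval a G R.* a R.+ a ^ᵣ n R.* a               ≈ᵣ.≈⟨ R.+-cong (R.*-assoc a (eval a G) a) (R.*-comm _ a) ⟩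
    a R.* (eval a G R.* a) R.+ a R.* a ^ᵣ n             ≈ᵣ.≈⟨ R.+-congʳ (R.*-congˡ (eval-powerQuotient a n)) ⟩
    a R.* (n ×ᵣ (a ^ᵣ n)) R.+ a R.* a ^ᵣ n              ≈ᵣ.≈⟨ R.+-congʳ (×ᵣ.×-comm-* n a (a ^ᵣ n)) ⟩
    n ×ᵣ (a R.* a ^ᵣ n) R.+ a R.* a ^ᵣ n                ≈ᵣ.≈⟨ R.+-comm _ _ ⟩
    suc n ×ᵣ (a ^ᵣ suc n)                               ≈ᵣ.∎
    where
    G : Poly
    G = powerQuotient X (C a) n

  eval-binom : ∀ a n u → eval a (binom n u) R.≈ a ^ᵣ n R.- u
  eval-binom a n u = R.trans (eval-- a (X ^ n) (C u))
    (R.+-cong (R.trans (eval-^ a X n) (^ᵣ.^-congˡ n (eval-X a))) (R.-‿cong (eval-C a u)))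

  -- If (x - a)² divides x^n - u, then aⁿ = u and a is also a root of (x^n - a^n) / (x - a). Hence n
  -- aⁿ = n u = 0, although n and u are both nonzero in the field.
  binom-squarefree : ∀ {n u} → ¬ p ℕ.∣ n → ¬ u R.≈ R.0# → ∀ a → ¬ lin a * lin a ∣ binom n u
  binom-squarefree {n} {u} p∤n u≉0 a lin²∣@(E , e) = n×u≉0 n×u≈0
    where
    G : Poly
    G = powerQuotient X (C a) n

    a^n≈u : a ^ᵣ n R.≈ u
    a^n≈u = RP.x∙y⁻¹≈ε⇒x≈y _ _ (R.trans (R.sym (eval-binom a n u)) (lin∣⇒root {a} (∣-trans (lin a , A.refl) lin²∣)))

    lin*G≈ : lin a * G ≈ binom n u
    lin*G≈ = begin
      lin a * G               ≈⟨ A.*-comm (lin a) G ⟩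
      G * lin a               ≈⟨ *-congˡ G (lin≈ a) ⟩
      G * (X - C a)           ≈⟨ powerQuotient-* X (C a) n ⟩
      X ^ n - C a ^ n         ≈⟨ +-congˡ (X ^ n) (A.-‿cong (A.trans (C-^ a n) (C-cong a^n≈u))) ⟩
      binom n u               ∎

    lin∣G : lin a ∣ G
    lin∣G = E , A.sym (monic-cancelˡ (lin a) G (E * lin a) (Monic-lin a) (begin
      lin a * G               ≈⟨ lin*G≈ ⟩
      binom n u               ≈⟨ e ⟨
      E * (lin a * lin a)     ≈⟨ solve 2 (λ l e → e :* (l :* l) := l :* (e :* l)) A.refl (lin a) E ⟩
      lin a * (E * lin a)     ∎))

    n×u≈0 : n ×ᵣ u R.≈ R.0#
    n×u≈0 = R.trans (×ᵣ.×-congʳ n (R.sym a^n≈u)) (R.trans (R.sym (eval-powerQuotient a n))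
      (R.trans (R.*-congʳ (lin∣⇒root lin∣G)) (R.zeroˡ a)))

    n×u≉0 : ¬ n ×ᵣ u R.≈ R.0#
    n×u≉0 e′ with integral {n ×ᵣ R.1#} {u} (R.trans (×ᵣ.×-assoc-* n R.1# u) (R.trans (×ᵣ.×-congʳ n (R.*-identityˡ u)) e′))
    ... | inj₁ n×1≈0 = p∤n⇒n×1≉0 p∤n n×1≈0
    ... | inj₂ u≈0   = u≉0 u≈0

  q-1 : ℕ
  q-1 = p ℕ.^ 2 ℕ.∸ 1

  q≡1+[q-1] : q ≡ suc q-1
  q≡1+[q-1] = ≡.trans q≡p² (≡.sym (ℕ.m+[n∸m]≡n (ℕ.≤-trans (ℕ.<⇒≤ 1<q) (ℕ.≤-reflexive q≡p²))))

  roots≈X*binom : roots els ≈ X * binom q-1 R.1#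
  roots≈X*binom = begin
    roots els                         ≈⟨ X^q-X≈roots ⟨
    X ^ q - X                         ≈⟨ A.+-cong (^-congʳ X q≡1+[q-1]) (A.-‿cong (A.sym (A.*-identityʳ X))) ⟩
    X * X ^ q-1 - X * 1ₚ              ≈⟨ AP.x[y-z]≈xy-xz X (X ^ q-1) 1ₚ ⟨
    X * binom q-1 R.1#                ∎

  -- Here x^n - u divides x^(ns) - u^s = x^(q-1) - 1, which divides x^q - x; the first power of the
  -- product over the field suffices.
  ∣⇒Splits : ∀ {n s u} → n ℕ.* s ≡ q-1 → u ^ᵣ s R.≈ R.1# → Splits n u
  ∣⇒Splits {n} {s} {u} ns≡ u^s≈1 = 1 , ∣-trans (binom∣binom n s u)
    (∣-respˡ (A.trans (binom-cong q-1 (R.sym u^s≈1)) (+-congʳ (A.- C (u ^ᵣ s)) (^-congʳ X (≡.sym ns≡))))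
      (∣-respʳ (A.trans (A.sym roots≈X*binom) (A.sym (A.*-identityʳ (roots els)))) (∣-*ˡ {binom q-1 R.1#} X ∣-refl)))

  private
    ^ᵣ≉0 : ∀ {u} n → ¬ u R.≈ R.0# → ¬ u ^ᵣ n R.≈ R.0#
    ^ᵣ≉0 zero    u≉0 = 1≉0
    ^ᵣ≉0 (suc n) u≉0 e with integral e
    ... | inj₁ u≈0   = u≉0 u≈0
    ... | inj₂ u^n≈0 = ^ᵣ≉0 n u≉0 u^n≈0

    0^≈0 : ∀ {n} → 0 < n → R.0# ^ᵣ n R.≈ R.0#
    0^≈0 {suc n} _ = R.zeroˡ _

  -- Simple roots bring the power of the product down to x^q - x = x (x^(q-1) - 1). The factor x
  -- drops out because x^n - u takes the value -u ≠ 0 at 0.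
  Splits⇒∣X^[q-1]-1 : ∀ {n u} → 0 < n → ¬ p ℕ.∣ n → ¬ u R.≈ R.0# → Splits n u → binom n u ∣ binom q-1 R.1#
  Splits⇒∣X^[q-1]-1 {n} {u} 0<n p∤n u≉0 (m , h) = ∣lin^*⇒∣ {R.0#} 1 (binom q-1 R.1#)
    (∣-respʳ (A.trans roots≈X*binom (*-congʳ (binom q-1 R.1#) (A.trans (A.sym lin0≈X) (A.sym (A.*-identityʳ (lin R.0#))))))
      (squarefree∣roots m (binom n u) (monic (Lead-binom {n} u 0<n)) (binom-squarefree p∤n u≉0) h))
    λ e → u≉0 (R.sym (RP.x∙y⁻¹≈ε⇒x≈y _ _ (R.trans (R.+-congʳ (R.sym (0^≈0 0<n))) (R.trans (R.sym (eval-binom R.0# n u)) e))))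

  -- Write q - 1 = t + s n with t < n. Then x^n - u divides u^s x^t - 1, which has degree below n
  -- and so vanishes; comparing leading terms gives t = 0 and u^s = 1.
  Splits⇒∣ : ∀ {n u} → 0 < n → ¬ p ℕ.∣ n → ¬ u R.≈ R.0# → Splits n u → ∃ λ s → n ℕ.* s ≡ q-1 × u ^ᵣ s R.≈ R.1#
  Splits⇒∣ {n@(suc _)} {u} 0<n p∤n u≉0 h = s ,
    ≡.trans (ℕ.*-comm n s) (≡.trans (≡.cong (ℕ._+ s ℕ.* n) (≡.sym (proj₁ t≡0×))) (≡.sym q-1≡)) , R.trans (R.sym (R.*-identityˡ _)) (proj₂ t≡0×)
    where
    s t : ℕ
    s = q-1 ℕ./ n
    t = q-1 ℕ.% n

    q-1≡ : q-1 ≡ t ℕ.+ s ℕ.* n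
    q-1≡ = ℕ.m≡m%n+[m/n]*n q-1 n

    -- Modulo X ^ n - u, the power X ^ (q - 1) reduces to u ^ s X ^ t.
    D∣ : binom n u ∣ X ^ t * C (u ^ᵣ s) - 1ₚ
    D∣ = ∣-respʳ rearrange (∣-- (binom n u) (Splits⇒∣X^[q-1]-1 0<n p∤n u≉0 h) (∣-*ˡ {binom n u} (X ^ t) (binom∣binom n s u)))
      where
      X^q-1≈ : X ^ q-1 ≈ X ^ t * X ^ (n ℕ.* s)
      X^q-1≈ = A.trans (^-congʳ X (≡.trans q-1≡ (≡.cong (t ℕ.+_) (ℕ.*-comm s n)))) (^-homo-* X t (n ℕ.* s))
      rearrange : binom q-1 R.1# - X ^ t * binom (n ℕ.* s) (u ^ᵣ s) ≈ X ^ t * C (u ^ᵣ s) - 1ₚ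
      rearrange = begin
        (X ^ q-1 - 1ₚ) - X ^ t * binom (n ℕ.* s) (u ^ᵣ s)       ≈⟨ +-congˡ (X ^ q-1 - 1ₚ) (A.-‿cong (A.trans (AP.x[y-z]≈xy-xz (X ^ t) (X ^ (n ℕ.* s)) (C (u ^ᵣ s))) (+-congʳ (A.- (X ^ t * C (u ^ᵣ s))) (A.sym X^q-1≈)))) ⟩
        (X ^ q-1 - 1ₚ) - (X ^ q-1 - X ^ t * C (u ^ᵣ s))         ≈⟨ +-congˡ (X ^ q-1 - 1ₚ) (AP.⁻¹-anti-homo‿- (X ^ q-1) (X ^ t * C (u ^ᵣ s))) ⟩
        (X ^ q-1 - 1ₚ) + (X ^ t * C (u ^ᵣ s) - X ^ q-1)         ≈⟨ A.+-comm (X ^ q-1 - 1ₚ) (X ^ t * C (u ^ᵣ s) - X ^ q-1) ⟩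
        (X ^ t * C (u ^ᵣ s) - X ^ q-1) + (X ^ q-1 - 1ₚ)         ≈⟨ telescope (X ^ t * C (u ^ᵣ s)) (X ^ q-1) 1ₚ ⟨
        X ^ t * C (u ^ᵣ s) - 1ₚ                                 ∎

    Lead-u^sX^t : Lead (X ^ t * C (u ^ᵣ s)) (t ℕ.+ 0) (R.1# R.* u ^ᵣ s)
    Lead-u^sX^t = Lead-* (Lead-X^ t) (mkLead R.refl λ { (suc _) _ → R.refl })

    small : ∀ k → n ℕ.≤ k → coeff (X ^ t * C (u ^ᵣ s) - 1ₚ) k R.≈ R.0#
    small k n≤k = R.trans (coeff-+ (X ^ t * C (u ^ᵣ s)) (A.- 1ₚ) k) (R.trans
      (R.+-cong (above Lead-u^sX^t k (ℕ.<-≤-trans (≡.subst (ℕ._< n) (≡.sym (ℕ.+-identityʳ t)) (ℕ.m%n<n q-1 n)) n≤k))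
                (R.trans (coeff-neg 1ₚ k) (R.trans (R.-‿cong (above Lead-1 k (ℕ.<-≤-trans 0<n n≤k))) RP.-0#≈0#)))
      (R.+-identityˡ R.0#))

    u^sX^t≈1 : X ^ t * C (u ^ᵣ s) ≈ 1ₚ
    u^sX^t≈1 = AP.x∙y⁻¹≈ε⇒x≈y (X ^ t * C (u ^ᵣ s)) 1ₚ (monic-small⇒0 (Lead-binom {n} u 0<n) D∣ small)

    t≡0× : t ≡ 0 × R.1# R.* u ^ᵣ s R.≈ R.1#
    t≡0× = let (t+0≡0 , l≈) = Lead-unique (λ e → ^ᵣ≉0 s u≉0 (R.trans (R.sym (R.*-identityˡ _)) e)) 1≉0 (Lead-resp u^sX^t≈1 Lead-u^sX^t) Lead-1
           in ≡.trans (≡.sym (ℕ.+-identityʳ t)) t+0≡0 , l≈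

  -- x^n - u divides x^(np) - u^p, and u^p = u.
  Splits-*p⁻¹ : ∀ {n u} → u ^ᵣ p R.≈ u → Splits (p ℕ.* n) u → Splits n u
  Splits-*p⁻¹ {n} {u} u^p≈u (m , h) = m , ∣-trans (binom∣binom n p u)
    (∣-respˡ (A.trans (binom-cong (p ℕ.* n) (R.sym u^p≈u)) (+-congʳ (A.- C (u ^ᵣ p)) (^-congʳ X (ℕ.*-comm p n)))) h)

  p×≈0 : ∀ P → p ×ₚ P ≈ 0ₚ
  p×≈0 P = mk≈ λ n → R.trans (coeff-× p P n) (R.trans (R.sym (×ᵣ.×-congʳ p (R.*-identityˡ (coeff P n))))
    (R.trans (R.sym (×ᵣ.×-assoc-* p R.1# (coeff P n))) (R.trans (R.*-congʳ p×1≈0) (R.zeroˡ _))))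
    where
    coeff-× : ∀ k P n → coeff (k ×ₚ P) n R.≈ k ×ᵣ coeff P n
    coeff-× zero    P n = R.refl
    coeff-× (suc k) P n = R.trans (coeff-+ P (k ×ₚ P) n) (R.+-congˡ (coeff-× k P n))

  -- x^(pn) - u is the p-th power of x^n - u. Frobenius is applied to the sum of x^n and the
  -- constant -u, hence the hypothesis on -u instead of u.
  Splits-*p : ∀ {n u} → (R.- u) ^ᵣ p R.≈ R.- u → Splits n u → Splits (p ℕ.* n) u
  Splits-*p {n} {u} -u^p≈ (m , E , e) = m ℕ.* p , E ^ p , (begin
    E ^ p * binom (p ℕ.* n) u         ≈⟨ *-congˡ (E ^ p) binom^p≈ ⟨
    E ^ p * binom n u ^ p             ≈⟨ ^-distrib-* E (binom n u) p ⟨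
    (E * binom n u) ^ p               ≈⟨ ^-congˡ p e ⟩
    (roots els ^ m) ^ p               ≈⟨ ^-assocʳ (roots els) m p ⟩
    roots els ^ (m ℕ.* p)             ∎)
    where
    binom^p≈ : binom n u ^ p ≈ binom (p ℕ.* n) u
    binom^p≈ = A.trans (Frobenius.frobenius A.commutativeSemiring p-prime p×≈0 (X ^ n) (C (R.- u)))
      (A.+-cong (A.trans (^-assocʳ X n p) (^-congʳ X (ℕ.*-comm n p))) (A.trans (C-^ (R.- u) p) (C-cong -u^p≈)))

-- The exponents

module Classification {a : Level} (p : ℕ) (p-prime : Prime p) (2∤p : ¬ 2 ℕ.∣ p) (P Q : ℕ → Set a)
  (∣⇒P : ∀ {n} → n ℕ.∣ p ℕ.^ 2 ℕ.∸ 1 → P n)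
  (P⇒∣ : ∀ {n} → 0 < n → ¬ p ℕ.∣ n → P n → n ℕ.∣ p ℕ.^ 2 ℕ.∸ 1)
  (P-*p : ∀ {n} → P n → P (p ℕ.* n))
  (P-*p⁻¹ : ∀ {n} → P (p ℕ.* n) → P n)
  (2∣⇒Q : ∀ {n} → 2 ℕ.* n ℕ.∣ p ℕ.^ 2 ℕ.∸ 1 → Q n)
  (Q⇒2∣ : ∀ {n} → 0 < n → ¬ p ℕ.∣ n → Q n → 2 ℕ.* n ℕ.∣ p ℕ.^ 2 ℕ.∸ 1)
  (Q-*p : ∀ {n} → Q n → Q (p ℕ.* n))
  (Q-*p⁻¹ : ∀ {n} → Q (p ℕ.* n) → Q n) where

  open import Data.Nat.Base using (_+_; _*_; _^_; _∸_; _≤_)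
  open import Data.Nat.Divisibility using (_∣_)

  private
    1<p : 1 < p
    1<p = prime>1 p-prime

    1<p² : 1 < p ^ 2
    1<p² = ℕ.<-≤-trans 1<p (ℕ.m≤m*n p (p * 1) {{ℕ.>-nonZero (ℕ.<-≤-trans (ℕ.<-trans z<s 1<p) (ℕ.m≤m*n p 1))}})

    p∤suc : ∀ {n} → p ∣ n → ¬ p ∣ suc n
    p∤suc {n} p∣n p∣n+1 = ℕ.<⇒≱ 1<p (ℕ.∣⇒≤ (ℕ.∣m+n∣m⇒∣n (≡.subst (p ∣_) (ℕ.+-comm 1 n) p∣n+1) p∣n))

    2*suc≡ : ∀ n → 2 * suc n ≡ 2 * n + 2
    2*suc≡ n = ≡.trans (ℕ.*-suc 2 n) (ℕ.+-comm 2 (2 * n))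

    ∣⇒<p² : ∀ {n} → n ∣ p ^ 2 ∸ 1 → n < p ^ 2
    ∣⇒<p² {n} n∣ = ℕ.≤-<-trans (ℕ.∣⇒≤ {{ℕ.>-nonZero (ℕ.m<n⇒0<n∸m 1<p²)}} n∣)
      (ℕ.∸-monoʳ-< {p ^ 2} {1} {0} z<s (ℕ.<⇒≤ 1<p²))

    p²≡p*p : p ^ 2 ≡ p * p
    p²≡p*p = ≡.cong (p *_) (ℕ.*-identityʳ p)

    *-pos : ∀ {m} n → 0 < m * n → 0 < m
    *-pos {suc m} n _ = z<s

    n*p*p≡n*p² : ∀ n → n * p * p ≡ n * p ^ 2
    n*p*p≡n*p² n = ≡.trans (ℕ.*-assoc n p p) (≡.cong (n *_) (≡.sym p²≡p*p))

    p²≤n*p² : ∀ {n} → 0 < n → p ^ 2 ≤ n * p ^ 2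
    p²≤n*p² {n} 0<n = ℕ.m≤n*m (p ^ 2) n {{ℕ.>-nonZero 0<n}}

    2*[m*n]≡ : ∀ m n → 2 * (m * n) ≡ 2 * m * n
    2*[m*n]≡ m n = ≡.sym (ℕ.*-assoc 2 m n)

  -- P n and Q n stand for the splitting of x^n - 1 and x^n + 1. Powers of p are stripped from
  -- whichever of r and r + 1 contains them, and the part prime to p then yields a divisor of p² -
  -- 1.
  toΩ : ∀ {r} → 0 < r → P r → Q (suc r) → Ω p r
  toΩ {r} 0<r Pr Qr+1 with p ℕ.∣? r
  ... | yes (ℕ.divides N ≡.refl) with p ℕ.∣? N
  ...   | no p∤N = inj₂ (inj₁ (N , *-pos p 0<r , ℕ.*-comm N p ,
          P⇒∣ (*-pos p 0<r) p∤N (P-*p⁻¹ (≡.subst P (ℕ.*-comm N p) Pr)) ,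
          ≡.subst (_∣ p ^ 2 ∸ 1) (≡.trans (2*suc≡ (N * p)) (≡.cong (_+ 2) (≡.trans (≡.cong (2 *_) (ℕ.*-comm N p)) (2*[m*n]≡ p N)))) 2[r+1]∣))
    where
    2[r+1]∣ : 2 * suc (N * p) ∣ p ^ 2 ∸ 1
    2[r+1]∣ = Q⇒2∣ z<s (p∤suc (ℕ.n∣m*n N)) Qr+1
  -- Here p² ∣ r, so 2(r + 1) exceeds p² and cannot divide p² - 1.
  ...   | yes (ℕ.divides N′ ≡.refl) = contradiction (∣⇒<p² 2[r+1]∣) (ℕ.≤⇒≯
          (ℕ.≤-trans (p²≤n*p² {N′} (*-pos p (*-pos p 0<r))) (ℕ.≤-trans (ℕ.≤-reflexive (≡.sym (n*p*p≡n*p² N′)))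
            (ℕ.≤-trans (ℕ.n≤1+n _) (ℕ.m≤n*m _ 2)))))
    where
    2[r+1]∣ : 2 * suc (N′ * p * p) ∣ p ^ 2 ∸ 1
    2[r+1]∣ = Q⇒2∣ z<s (p∤suc (ℕ.n∣m*n (N′ * p))) Qr+1
  toΩ {r} 0<r Pr Qr+1 | no p∤r with p ℕ.∣? suc r
  ... | no p∤r+1 = inj₁ (0<r , P⇒∣ 0<r p∤r Pr , ≡.subst (_∣ p ^ 2 ∸ 1) (2*suc≡ r) (Q⇒2∣ z<s p∤r+1 Qr+1))
  ... | yes (ℕ.divides M r+1≡) = quotient (p ℕ.∣? M)
    where
    0<M : 0 < M
    0<M = *-pos p (≡.subst (0 <_) r+1≡ z<s)
    QM : Q M
    QM = Q-*p⁻¹ (≡.subst Q (≡.trans r+1≡ (ℕ.*-comm M p)) Qr+1)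
    r∣ : r ∣ p ^ 2 ∸ 1
    r∣ = P⇒∣ 0<r p∤r Pr
    quotient : _ → Ω p r
    -- The witness is 2 M, because `Q⇒2∣` makes 2 M, and not just M, a divisor of p² - 1.
    quotient (no p∤M) = inj₂ (inj₂ (inj₁ (0<r , r∣ , 2 * M , ℕ.*-mono-< {0} {2} {0} {M} z<s 0<M ,
      Q⇒2∣ 0<M p∤M QM , ≡.trans (≡.sym (2*suc≡ r)) (≡.trans (≡.cong (2 *_) r+1≡) (2*[m*n]≡ M p)))))
    quotient (yes (ℕ.divides M′ M≡)) with p ℕ.∣? M′
    ... | no p∤M′ = inj₂ (inj₂ (inj₂ (0<r , r∣ , 2 * M′ , ℕ.*-mono-< {0} {2} {0} {M′} z<s 0<M′ ,
            Q⇒2∣ 0<M′ p∤M′ (Q-*p⁻¹ (≡.subst Q (≡.trans M≡ (ℕ.*-comm M′ p)) QM)) ,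
            ≡.trans (≡.sym (2*suc≡ r)) (≡.trans (≡.cong (2 *_) r+1≡M′p²) (2*[m*n]≡ M′ (p ^ 2))))))
      where
      0<M′ : 0 < M′
      0<M′ = *-pos p (≡.subst (0 <_) M≡ 0<M)
      r+1≡M′p² : suc r ≡ M′ * p ^ 2
      r+1≡M′p² = ≡.trans r+1≡ (≡.trans (≡.cong (_* p) M≡) (n*p*p≡n*p² M′))
    -- Here p³ ∣ r + 1, whereas r ∣ p² - 1 gives r + 1 ≤ p².
    ... | yes (ℕ.divides M″ M′≡) = contradiction (∣⇒<p² r∣) (ℕ.≤⇒≯ (ℕ.≤-pred (ℕ.≤-trans
            (ℕ.<-≤-trans p²<p*p² (ℕ.m≤n*m (p * p ^ 2) M″ {{ℕ.>-nonZero (*-pos p (≡.subst (0 <_) M′≡ 0<M′))}})) (ℕ.≤-reflexive (≡.sym r+1≡M″pp²)))))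
      where
      0<M′ : 0 < M′
      0<M′ = *-pos p (≡.subst (0 <_) M≡ 0<M)
      p²<p*p² : p ^ 2 < p * p ^ 2
      p²<p*p² = ≡.subst (p ^ 2 <_) (ℕ.*-comm (p ^ 2) p) (ℕ.m<m*n (p ^ 2) p {{ℕ.>-nonZero (ℕ.<-trans z<s 1<p²)}} 1<p)
      r+1≡M″pp² : suc r ≡ M″ * (p * p ^ 2)
      r+1≡M″pp² = ≡.trans r+1≡ (≡.trans (≡.cong (_* p) M≡) (≡.trans (n*p*p≡n*p² M′)
        (≡.trans (≡.cong (_* p ^ 2) M′≡) (ℕ.*-assoc M″ p (p ^ 2)))))

  private
    -- M k is even and k is odd, so 2 divides M. It is applied with k = p and k = p².
    halve : ∀ {r M k} → M ∣ p ^ 2 ∸ 1 → ¬ 2 ∣ k → 2 * r + 2 ≡ M * k → ∃ λ M′ → 2 * M′ ∣ p ^ 2 ∸ 1 × suc r ≡ M′ * k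
    halve {r} {M} {k} M∣ 2∤k e
      with euclidsLemma M k prime[2] (≡.subst (2 ∣_) (≡.trans (2*suc≡ r) e) (ℕ.m∣m*n (suc r)))
    ... | inj₂ 2∣k = contradiction 2∣k 2∤k
    ... | inj₁ (ℕ.divides M′ ≡.refl) = M′ , ≡.subst (_∣ p ^ 2 ∸ 1) (ℕ.*-comm M′ 2) M∣ ,
      ℕ.*-cancelˡ-≡ (suc r) (M′ * k) 2 (≡.trans (2*suc≡ r) (≡.trans e (≡.trans (≡.cong (_* k) (ℕ.*-comm M′ 2)) (ℕ.*-assoc 2 M′ k))))

    2∤p² : ¬ 2 ∣ p ^ 2
    2∤p² 2∣p² with euclidsLemma p p prime[2] (≡.subst (2 ∣_) p²≡p*p 2∣p²)
    ... | inj₁ 2∣p = 2∤p 2∣p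
    ... | inj₂ 2∣p = 2∤p 2∣p

  fromΩ : ∀ {r} → Ω p r → P r × Q (suc r)
  fromΩ {r} (inj₁ (0<r , r∣ , 2r+2∣)) = ∣⇒P r∣ , 2∣⇒Q (≡.subst (_∣ p ^ 2 ∸ 1) (≡.sym (2*suc≡ r)) 2r+2∣)
  fromΩ (inj₂ (inj₁ (N , 0<N , ≡.refl , N∣ , 2pN+2∣))) = P-*p (∣⇒P N∣) ,
    2∣⇒Q (≡.subst (_∣ p ^ 2 ∸ 1) (≡.trans (≡.cong (_+ 2) (≡.sym (2*[m*n]≡ p N))) (≡.sym (2*suc≡ (p * N)))) 2pN+2∣)
  fromΩ {r} (inj₂ (inj₂ (inj₁ (0<r , r∣ , M , 0<M , M∣ , 2r+2≡)))) = ∣⇒P r∣ ,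
    let (M′ , 2M′∣ , r+1≡) = halve M∣ 2∤p 2r+2≡ in ≡.subst Q (≡.trans (ℕ.*-comm p M′) (≡.sym r+1≡)) (Q-*p (2∣⇒Q 2M′∣))
  fromΩ {r} (inj₂ (inj₂ (inj₂ (0<r , r∣ , M , 0<M , M∣ , 2r+2≡)))) = ∣⇒P r∣ ,
    let (M′ , 2M′∣ , r+1≡) = halve M∣ 2∤p² 2r+2≡
    in ≡.subst Q (≡.trans (ℕ.*-comm p (p * M′)) (≡.trans (≡.cong (_* p) (ℕ.*-comm p M′)) (≡.trans (n*p*p≡n*p² M′) (≡.sym r+1≡)))) (Q-*p (Q-*p (2∣⇒Q 2M′∣)))

-- From a Heyting field of finite order to a decidable field

module FromHeyting {c ℓ₁ ℓ₂ : Level} (F : HeytingField c ℓ₁ ℓ₂) {q : ℕ} (1<q : 1 < q) (order : HasOrder F q) where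

  private
    module F = HeytingField F
    module R = CommutativeRing (fieldRing F)
    open Inverse order using (to; from; to-cong; from-cong; strictlyInverseˡ; strictlyInverseʳ)

    to-injective : ∀ {x y} → to x ≡ to y → x R.≈ y
    to-injective {x} {y} e = R.trans (R.sym (strictlyInverseʳ x)) (R.trans (from-cong e) (strictlyInverseʳ y))

    -- If 1 = 0, all elements coincide, and then so do the indices 0 and 1 in `Fin q`.
    1≉0 : ¬ R.1# R.≈ R.0#
    1≉0 1≈0 = contradiction (≡.trans (≡.sym (Fin.toℕ-fromℕ< 0<q)) (≡.trans (≡.cong Fin.toℕ (all≡ (fromℕ< 0<q) (fromℕ< 1<q))) (Fin.toℕ-fromℕ< 1<q))) λ ()
      where
      0<q : 0 < q
      0<q = ℕ.<-trans z<s 1<q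
      ≈0 : ∀ x → x R.≈ R.0#
      ≈0 x = R.trans (R.sym (R.*-identityˡ x)) (R.trans (R.*-congʳ 1≈0) (R.zeroˡ x))
      all≡ : ∀ i j → i ≡ j
      all≡ i j = ≡.trans (≡.sym (strictlyInverseˡ i)) (≡.trans (to-cong (R.trans (≈0 (from i)) (R.sym (≈0 (from j))))) (strictlyInverseˡ j))

    _≟_ : ∀ x y → Dec (x R.≈ y)
    x ≟ y = map′ to-injective to-cong (to x Fin.≟ to y)

    -- Tightness only refutes the absence of an inverse. Since the field is finite, the existence of
    -- one is decidable, and the double negation can be removed.
    inverse : ∀ {x} → ¬ x R.≈ R.0# → ∃ λ y → y R.* x R.≈ R.1#
    inverse {x} x≉0 = let (i , e) = decidable-stable (Fin.any? λ i → (from i R.* x) ≟ R.1#) ¬¬inverse in from i , e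
      where
      ¬¬inverse : ¬ ¬ (∃ λ i → from i R.* x R.≈ R.1#)
      ¬¬inverse none = x≉0 (proj₁ (F.tight x R.0#) λ x#0 →
        let (y , y[x-0]≈1 , _) = F.#⇒invertible x#0 in none (to y , R.trans
          (R.*-cong (strictlyInverseʳ y) (R.sym (R.trans (R.+-congˡ (RingProperties.-0#≈0# R.ring)) (R.+-identityʳ x)))) y[x-0]≈1))

  isDecidableField : IsDecidableField (fieldRing F)
  isDecidableField = record { _≟_ = _≟_ ; 1≉0 = 1≉0 ; inverse = inverse }

  elements : List F.Carrier
  elements = tabulate from

  elements! : UniqueSetoid.Unique R.setoid elements
  elements! = UniqueP.tabulate⁺ R.setoid λ {i} {j} e →
    ≡.trans (≡.sym (strictlyInverseˡ i)) (≡.trans (to-cong e) (strictlyInverseˡ j))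

  ∈-elements : ∀ a → Membership._∈_ R.setoid a elements
  ∈-elements a = MembershipP.∈-resp-≈ R.setoid (strictlyInverseʳ a) (MembershipP.∈-tabulate⁺ R.setoid (to a))

  |elements|≡q : length elements ≡ q
  |elements|≡q = List.length-tabulate from

-- Parity and powers of -1

private
  parity : ∀ n → (∃ λ k → n ≡ 2 ℕ.* k) ⊎ (∃ λ k → n ≡ suc (2 ℕ.* k))
  parity zero    = inj₁ (0 , ≡.refl)
  parity (suc n) with parity n
  ... | inj₁ (k , e) = inj₂ (k , ≡.cong suc e)
  ... | inj₂ (k , e) = inj₁ (suc k , ≡.trans (≡.cong suc e) (≡.sym (ℕ.*-suc 2 k)))

module Signs {c ℓ : Level} (R : CommutativeRing c ℓ) where

  open CommutativeRing R
  open RingProperties ring using (-‿involutive; -1*x≈-x)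
  open Exp semiring

  1^≈1 : ∀ n → 1# ^ n ≈ 1#
  1^≈1 zero    = refl
  1^≈1 (suc n) = trans (*-identityˡ _) (1^≈1 n)

  -1^even≈1 : ∀ k → (- 1#) ^ (2 ℕ.* k) ≈ 1#
  -1^even≈1 k = trans (sym (^-assocʳ (- 1#) 2 k)) (trans (^-congˡ k
    (trans (*-congˡ (*-identityʳ _)) (trans (-1*x≈-x (- 1#)) (-‿involutive 1#)))) (1^≈1 k))

  -1^odd≈-1 : ∀ k → (- 1#) ^ suc (2 ℕ.* k) ≈ - 1#
  -1^odd≈-1 k = trans (*-congˡ (-1^even≈1 k)) (*-identityʳ _)

open import Relation.Unary using (_∈_)

theorem4p1 : ∀ {c ℓ₁ ℓ₂} (p : ℕ) → Prime p → ¬ (2 ℕ.∣ p) →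
    (F : HeytingField c ℓ₁ ℓ₂) → HasOrder F (p ℕ.^ 2) →
    (r : ℕ) → .{{_ : NonZero r}} →
    let open Polynomial (fieldRing F) in
    BiUnitaryPerfect ((X ^ (p ℕ.^ 2) - X) ^ (2 ℕ.* r)) ⇔ (r ∈ Ω p)
-- The argument runs over an enumeration of F, whose length is p² by a proved equality; the result
-- is transported along it.
theorem4p1 {c} {ℓ₁} p p-prime 2∤p F order r = ≡.subst (λ k → BiUnitaryPerfect ((X ^ k - X) ^ (2 ℕ.* r)) ⇔ (r ∈ Ω p))
    |elements|≡q (splits⇔Ω ⇔-∘ (σX∣roots^⇔ r ⇔-∘ perfect⇔σX∣roots^ r 0<r))
  where
  R : CommutativeRing c ℓ₁
  R = fieldRing F

  module R = CommutativeRing R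

  1<p : 1 < p
  1<p = prime>1 p-prime

  0<r : 0 < r
  0<r = ℕ.>-nonZero⁻¹ r

  1<p² : 1 < p ℕ.^ 2
  1<p² = ℕ.<-≤-trans 1<p (ℕ.≤-trans (ℕ.m≤m*n p p {{ℕ.>-nonZero (ℕ.<-trans z<s 1<p)}}) (ℕ.≤-reflexive (≡.cong (p ℕ.*_) (≡.sym (ℕ.*-identityʳ p)))))

  p∤2 : ¬ p ℕ.∣ 2
  p∤2 p∣2 with prime⇒irreducible prime[2] p∣2
  ... | inj₁ p≡1 = ℕ.<⇒≢ 1<p (≡.sym p≡1)
  ... | inj₂ p≡2 = 2∤p (≡.subst (2 ℕ.∣_) (≡.sym p≡2) ℕ.∣-refl)

  open Polynomial R
  open FromHeyting F 1<p² order
  1<|elements| : 1 < length elements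
  1<|elements| = ≡.subst (1 <_) (≡.sym |elements|≡q) 1<p²
  open Perfect R isDecidableField elements elements! ∈-elements 1<|elements|
  open Splitting R isDecidableField elements elements! ∈-elements 1<|elements| p p-prime p∤2 |elements|≡q
  open IsDecidableField isDecidableField using (1≉0)
  open RingProperties R.ring using (-‿involutive; -0#≈0#; -‿injective)
  open Exp R.semiring using (^-congˡ) renaming (_^_ to _^ᵣ_)
  open Signs R

  -1≉0 : ¬ R.- R.1# R.≈ R.0#
  -1≉0 e = 1≉0 (-‿injective (R.trans e (R.sym -0#≈0#)))

  -1^p≈-1 : (R.- R.1#) ^ᵣ p R.≈ R.- R.1#
  -1^p≈-1 with parity p
  ... | inj₁ (k , ≡.refl) = contradiction (ℕ.m∣m*n k) 2∤p
  ... | inj₂ (k , ≡.refl) = -1^odd≈-1 k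

  -[-1]^p≈-[-1] : (R.- (R.- R.1#)) ^ᵣ p R.≈ R.- (R.- R.1#)
  -[-1]^p≈-[-1] = R.trans (^-congˡ p (-‿involutive R.1#)) (R.trans (1^≈1 p) (R.sym (-‿involutive R.1#)))

  -1^≈1⇒2∣ : ∀ s → (R.- R.1#) ^ᵣ s R.≈ R.1# → 2 ℕ.∣ s
  -1^≈1⇒2∣ s e with parity s
  ... | inj₁ (k , ≡.refl) = ℕ.m∣m*n k
  ... | inj₂ (k , ≡.refl) = contradiction (R.trans (R.sym (-1^odd≈-1 k)) e) -1≉1

  splits₊ : ∀ {n} → n ℕ.∣ q-1 → Splits n R.1#
  splits₊ {n} (ℕ.divides s e) = ∣⇒Splits (≡.trans (ℕ.*-comm n s) (≡.sym e)) (1^≈1 s)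

  splits₊⁻¹ : ∀ {n} → 0 < n → ¬ p ℕ.∣ n → Splits n R.1# → n ℕ.∣ q-1
  splits₊⁻¹ {n} 0<n p∤n h = let (s , e , _) = Splits⇒∣ 0<n p∤n 1≉0 h in ℕ.divides s (≡.trans (≡.sym e) (ℕ.*-comm n s))

  splits₋ : ∀ {n} → 2 ℕ.* n ℕ.∣ q-1 → Splits n (R.- R.1#)
  splits₋ {n} (ℕ.divides s e) = ∣⇒Splits {n} {2 ℕ.* s} (≡.trans (ℕ.*-comm n (2 ℕ.* s))
    (≡.trans (≡.cong (ℕ._* n) (ℕ.*-comm 2 s)) (≡.trans (ℕ.*-assoc s 2 n) (≡.sym e)))) (-1^even≈1 s)

  -- From n s = q - 1 and (-1)^s = 1, where -1 ≠ 1, the exponent s is even. Its factor 2 is what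
  -- separates x^n + 1 from x^n - 1.
  splits₋⁻¹ : ∀ {n} → 0 < n → ¬ p ℕ.∣ n → Splits n (R.- R.1#) → 2 ℕ.* n ℕ.∣ q-1
  splits₋⁻¹ {n} 0<n p∤n h = let (s , e , -1^s≈1) = Splits⇒∣ 0<n p∤n -1≉0 h in
    ≡.subst (2 ℕ.* n ℕ.∣_) (≡.trans (ℕ.*-comm s n) e) (ℕ.*-monoˡ-∣ n (-1^≈1⇒2∣ s -1^s≈1))

  -- For u = 1 the constant term is -1, and p odd makes it equal to its p-th power.
  splits₊-*p : ∀ {n} → Splits n R.1# → Splits (p ℕ.* n) R.1#
  splits₊-*p {n} = Splits-*p {n} -1^p≈-1

  splits₊-*p⁻¹ : ∀ {n} → Splits (p ℕ.* n) R.1# → Splits n R.1#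
  splits₊-*p⁻¹ {n} = Splits-*p⁻¹ {n} (1^≈1 p)

  splits₋-*p : ∀ {n} → Splits n (R.- R.1#) → Splits (p ℕ.* n) (R.- R.1#)
  splits₋-*p {n} = Splits-*p {n} -[-1]^p≈-[-1]

  splits₋-*p⁻¹ : ∀ {n} → Splits (p ℕ.* n) (R.- R.1#) → Splits n (R.- R.1#)
  splits₋-*p⁻¹ {n} = Splits-*p⁻¹ {n} -1^p≈-1

  open Classification p p-prime 2∤p (λ n → Splits n R.1#) (λ n → Splits n (R.- R.1#))
    splits₊ splits₊⁻¹ splits₊-*p splits₊-*p⁻¹ splits₋ splits₋⁻¹ splits₋-*p splits₋-*p⁻¹

  splits⇔Ω : (Splits r R.1# × Splits (suc r) (R.- R.1#)) ⇔ Ω p r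
  splits⇔Ω = mk⇔ (λ (h , k) → toΩ 0<r h k) fromΩ
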